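{- Let $\mathcal{C}$ be a clone on $\{0,1\}$. If $\mathcal{C}$ is included in $\Lambda$, $V$ or $L$, then $\mathcal{C}^{(\geq 4)}$ is reconstructible. Otherwise, $\mathcal{C}^{(\geq n)}$ is not weakly reconstructible for any $n \geq 1$, and $\mathcal{C}$ contains pairs of nonequivalent strongly hypomorphic functions of arbitrarily high arity.
   Context: A Boolean function is a map $f\colon\{0,1\}^n\to\{0,1\}$ for some integer $n\ge 1$, its arity. A clone on $\{0,1\}$ is a class of Boolean functions that contains all projections $(a_1,\dots,a_n)\mapsto a_i$ and is closed under composition $f(g_1,\dots,g_n)(\mathbf a)=f(g_1(\mathbf a),\dots,g_n(\mathbf a))$. For a class $\mathcal C$ of Boolean functions, $\mathcal C^{(\ge n)}$ is the set of members of $\mathcal C$ of arity at least $n$. $\Lambda$ is the clone of all polynomial operations of the two-element meet-semilattice $(\{0,1\};\wedge)$ (i.e. all constant functions and all conjunctions of a nonempty set of arguments); $V$ is the clone of all polynomial operations of the two-element join-semilattice $(\{0,1\};\vee)$ (all constant functions and all disjunctions of a nonempty set of arguments); $L$ is the clone of all polynomial operations of the group of addition modulo $2$ (all affine functions over the two-element field). Functions are allowed to have inessential arguments. Write $[n]=\{1,\dots,n\}$. For $\mathbf a=(a_1,\dots,a_n)$ and $\sigma\colon[m]\to[n]$ let $\mathbf a\sigma=(a_{\sigma(1)},\dots,a_{\sigma(m)})$. A function $f$ of arity $n$ is a minor of a function $g$ of arity $m$, written $f\le g$, if there is a map $\sigma\colon[m]\to[n]$ with $f(\mathbf a)=g(\mathbf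 a\sigma)$ for all $\mathbf a\in\{0,1\}^n$. Functions $f,g$ are equivalent, $f\equiv g$, if $f\le g$ and $g\le f$; for $f,g$ of the same arity $n$ this means that $f(\mathbf a)=g(\mathbf a\sigma)$ for all $\mathbf a$, for some permutation $\sigma$ of $[n]$. For $f$ of arity $n\ge2$ and a two-element set $I=\{i,j\}\subseteq[n]$, $i<j$, the identification minor $f_I$ is the function of arity $n-1$ given by $f_I(a_1,\dots,a_{n-1})=f(a_1,\dots,a_{j-1},a_i,a_j,\dots,a_{n-1})$. The deck of $f$ is the multiset of the equivalence classes $f_I/{\equiv}$, with $I$ ranging over all two-element subsets of $[n]$. Two functions $f,g$ of the same arity $n$ are hypomorphic ($g$ is a reconstruction of $f$) if they have the same deck, and strongly hypomorphic if $f_I\equiv g_I$ for every two-element $I\subseteq[n]$. A function is reconstructible if it is equivalent to all of its reconstructions (among all Boolean functions of the same arity). A class $\mathcal C$ is reconstructible if all its members are reconstructible; it is weakly reconstructible if for every $f\in\mathcal C$, all reconstructions of $f$ that belong to $\mathcal C$ are equivalent to $f$. -}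

module Defs where

open import Data.Bool.Base using (Bool; _∧_; _∨_; _xor_)
open import Data.Fin.Base using (Fin; Fin′; inject!)
open import Data.Nat.Base using (ℕ; suc; _≤_)
open import Data.Product.Base using (Σ-syntax; ∃-syntax; _×_; _,_)
open import Data.Vec.Base using (Vec; lookup; tabulate; insertAt)
open import Function.Base using (_∘_)
open import Function.Bundles using (_↔_; Inverse)
open import Level using (Level; 0ℓ) renaming (suc to lsuc)
open import Relation.Binary.PropositionalEquality.Core using (_≡_; _≗_)
open import Relation.Unary using (Pred; _∈_)

private
  variable
    ℓ ℓ₁ ℓ₂ : Level
    m n     : ℕ

Op : ℕ → Set
Op n = Vec Bool n → Bool

-- Boolean functions have arity at least 1, so the arity of a member of a
-- class is always a successor.  (Op 0 only occurs as the codomain type of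
-- identification minors of unary functions, of which there are none.)

Class : (ℓ : Level) → Set (lsuc ℓ)
Class ℓ = ∀ {n} → Pred (Op (suc n)) ℓ

_⊑_ : Class ℓ₁ → Class ℓ₂ → Set _
C ⊑ D = ∀ {n} (f : Op (suc n)) → f ∈ C → f ∈ D

infix 4 _⊑_

_^≥_ : Class ℓ → ℕ → Class ℓ
(C ^≥ m) {n} f = f ∈ C × m ≤ suc n

-- Functions are identified when they are pointwise equal; in the absence of
-- function extensionality, membership has to respect this explicitly.

record IsClone (C : Class ℓ) : Set ℓ where
  field
    resp-≗      : {f g : Op (suc n)} → f ≗ g → f ∈ C → g ∈ C
    projection  : (i : Fin (suc n)) → (λ a → lookup a i) ∈ C
    composition : (f : Op (suc m)) (g : Fin (suc m) → Op (suc n)) →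
                  f ∈ C → (∀ i → g i ∈ C) →
                  (λ a → f (tabulate (λ i → g i a))) ∈ C

data Polynomial (n : ℕ) : Set where
  var   : Fin n → Polynomial n
  const : Bool → Polynomial n
  _·_   : Polynomial n → Polynomial n → Polynomial n

⟦_⟧ : Polynomial n → (Bool → Bool → Bool) → Op n
⟦ var i   ⟧ _∙_ a = lookup a i
⟦ const b ⟧ _∙_ a = b
⟦ s · t   ⟧ _∙_ a = ⟦ s ⟧ _∙_ a ∙ ⟦ t ⟧ _∙_ a

PolynomialOperations : (Bool → Bool → Bool) → Class 0ℓ
PolynomialOperations _∙_ {n} f = ∃[ t ] f ≗ ⟦_⟧ {suc n} t _∙_

Λ : Class 0ℓ
Λ = PolynomialOperations _∧_

V : Class 0ℓ
V = PolynomialOperations _∨_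

-- In the group of addition modulo 2, negation is the identity map and the
-- neutral element is a constant, so addition is the only operation needed.

L : Class 0ℓ
L = PolynomialOperations _xor_

_[_] : Vec Bool n → (Fin m → Fin n) → Vec Bool m
a [ σ ] = tabulate (lookup a ∘ σ)

_≼_ : Op n → Op m → Set
_≼_ {n} {m} f g = Σ[ σ ∈ (Fin m → Fin n) ] (∀ a → f a ≡ g (a [ σ ]))

_≈_ : Op n → Op m → Set
f ≈ g = f ≼ g × g ≼ f

infix 4 _≼_ _≈_

-- The pair (j , i) stands for the two-element subset {i, j} with i < j:
-- Fin′ j is the type of elements strictly below j.

TwoSubset : ℕ → Set
TwoSubset n = Σ[ j ∈ Fin n ] Fin′ j

-- The argument tuple is (a₁, …, a_{j-1}, aᵢ, a_j, …, aₙ), that is, aᵢ is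
-- inserted into a so as to become its j-th entry; inject! i is i itself,
-- viewed as a position in a.

identify : Op (suc n) → TwoSubset (suc n) → Op n
identify f (j , i) a = f (insertAt a j (lookup a (inject! i)))

-- Equality of the multisets of the classes f_I/≈ and g_I/≈: a bijection of
-- the index set that matches equivalent identification minors.

Hypomorphic : Op (suc n) → Op (suc n) → Set
Hypomorphic {n} f g =
  Σ[ π ∈ (TwoSubset (suc n) ↔ TwoSubset (suc n)) ]
    (∀ I → identify f I ≈ identify g (Inverse.to π I))

StronglyHypomorphic : Op (suc n) → Op (suc n) → Set
StronglyHypomorphic f g = ∀ I → identify f I ≈ identify g I

ReconstructibleFunction : Op (suc n) → Set
ReconstructibleFunction f = ∀ g → Hypomorphic f g → f ≈ g

Reconstructible : Class ℓ → Set ℓ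
Reconstructible C = ∀ {n} (f : Op (suc n)) → f ∈ C → ReconstructibleFunction f

WeaklyReconstructible : Class ℓ → Set ℓ
WeaklyReconstructible C =
  ∀ {n} (f g : Op (suc n)) → f ∈ C → g ∈ C → Hypomorphic f g → f ≈ g

{-# OPTIONS --safe #-}

-- Members of Λ and L are the functions preserving x ∧ y and x + y + z.  Such a
-- condition involves a pair (a , b) of tuples with at most four different
-- columns (aᵢ , bᵢ), so that for arity at least 4 it is inherited from the
-- identification minors.  A function with an inessential argument is a minor
-- of one of its cards, hence of each of its reconstructions; it remains to
-- count the inessential arguments of the cards.  V is dual to Λ.
--
-- A clone outside Λ, V and L contains the majority function, x ∧ (y ∨ z) or
-- its dual.  For strongly hypomorphic members, split 2m arguments into blocks
-- of two.  A tuple choosing one argument from each block gets a value by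
-- parity; other tuples get values by which a block c and its successor s c
-- single out one of the two arguments of c.  These exceptional tuples separate
-- an argument of the block s c from those of all blocks other than c and s c.
-- Identifying such a pair hides them, after which exchanging the arguments of
-- c exchanges the two parities.  Without any identification the exceptional
-- tuples determine which argument of each block is which, and the two parities
-- give inequivalent functions.

module Submission where

open import Defs
open import Data.Bool.Base using (Bool; true; false; not; _∧_; _∨_; _xor_; if_then_else_)
open import Data.Fin.Base using (Fin; zero; suc; inject!; punchIn; punchOut; _<_; splitAt; _↑ˡ_; _↑ʳ_; combine; remQuot) renaming (join to joinFin)
open import Data.Fin.Properties using (_≟_; any?; ¬∀⟶∃¬; <-cmp; <⇒≢; pigeonhole; punchInᵢ≢i; punchIn-punchOut; punchOut-punchIn; punchOut-injective; punchOut-cong; splitAt-↑ˡ; splitAt-↑ʳ; join-splitAt; remQuot-combine; combine-remQuot) renaming (all? to allFin?)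
open import Data.Nat.Base as ℕ using (ℕ; suc; zero; _≤_; s≤s; z≤n; _+_; _*_)
open import Data.Product.Base using (Σ-syntax; ∃; ∃-syntax; ∃₂; _×_; _,_; proj₁; proj₂)
open import Data.Sum.Base using (_⊎_; inj₁; inj₂; [_,_]′)
open import Data.Vec.Base using (Vec; []; _∷_; lookup; tabulate; insertAt; zipWith; replicate; map; _++_; allFin)
open import Data.Vec.Properties using (lookup∘tabulate; tabulate∘lookup; tabulate-cong; insertAt-lookup; insertAt-punchIn; lookup-zipWith; lookup-replicate; lookup-map)
open import Function.Base using (_∘_; id)
open import Function.Bundles using (Inverse)
open import Function.Definitions using (Injective)
open import Relation.Binary.Definitions using (tri<; tri≈; tri>)
open import Relation.Binary.PropositionalEquality using (_≡_; _≢_; _≗_; refl; sym; trans; cong; cong₂; subst; ≢-sym)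
open import Relation.Nullary using (¬_; Dec; yes; no; contradiction; does)
open import Data.Bool.Properties using (not-involutive; ∧-identityʳ; ∧-zeroʳ; ¬-not; not-¬; ∨-zeroʳ; not-distribˡ-xor; not-distribʳ-xor) renaming (_≟_ to _≟ᵇ_)
open import Relation.Nullary.Decidable using (¬?; _×-dec_; decidable-stable; dec-true; dec-false; _⊎-dec_; _→-dec_; from-yes; map′)
open import Relation.Unary using (_∈_; Decidable)
open import Data.Nat.Properties using (≤-trans; n≤1+n; n<1+n; m≤m+n; ≤-refl; m≤n+m)
open import Function.Construct.Symmetry using (↔-sym)
open import Axiom.ExcludedMiddle using (ExcludedMiddle)
open import Data.List.Base using (List; []; _∷_) renaming (map to mapᴸ)
open import Data.List.Relation.Unary.Any using (Any; satisfied; here; there) renaming (any? to anyList?)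
open import Level using (Level; 0ℓ; lift) renaming (lower to unlift)
open import Data.Vec.Membership.Propositional as Vec using ()
open import Data.Vec.Membership.Propositional.Properties using (∈-++⁺ˡ; ∈-++⁺ʳ; ∈-map⁺; ∈-allFin⁺)
open import Data.Vec.Relation.Unary.All as All using (All; []; _∷_)
open import Data.Vec.Relation.Unary.Any using (here)
open import Data.List.Membership.Propositional using () renaming (_∈_ to _∈ᴸ_; _∉_ to _∉ᴸ_)
open import Data.List.Membership.Propositional.Properties using () renaming (∈-map⁺ to ∈ᴸ-map⁺)
open import Data.Product.Properties using (≡-dec)
open import Function.Construct.Identity using (↔-id)

-- `F β` is monotone but lies in neither minimal clone: no single argument bounds it, and it is not
-- selfdual. A further argument, `zero`, repairs this. In `guardOp` it is a bound; in `choiceOp` it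
-- selects between `F β` and its dual. The latter is monotone only if `F β` never holds at both a
-- configuration and its complement. Complementing a choice of one point per block changes its
-- parity exactly when the number `m` of blocks is odd, whence `m-odd`.
--
-- The exceptional configurations have to be felt by the whole function but by none of its cards.
-- When points of distinct blocks p and q are merged, this calls for a block c, different from both,
-- whose successor is p or q. Cycles of length three always supply one, whereas a cycle consisting
-- of p and q alone would not. This is why `s` has order three and no fixed point.

private
  variable
    k l m n : ℕ
    ℓ : Level

-- Tuples, minors and counting

vec-ext : {a b : Vec Bool n} → (∀ i → lookup a i ≡ lookup b i) → a ≡ b
vec-ext {a = a} {b} a≗b =
  trans (sym (tabulate∘lookup a)) (trans (tabulate-cong a≗b) (tabulate∘lookup b))

lookup-[] : (a : Vec Bool n) (σ : Fin m → Fin n) (i : Fin m) → lookup (a [ σ ]) i ≡ lookup a (σ i)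
lookup-[] a σ = lookup∘tabulate (lookup a ∘ σ)

[]-cong : (a : Vec Bool n) {σ τ : Fin m → Fin n} → σ ≗ τ → a [ σ ] ≡ a [ τ ]
[]-cong a σ≗τ = tabulate-cong (cong (lookup a) ∘ σ≗τ)

[]-∘ : (a : Vec Bool n) (σ : Fin m → Fin n) (τ : Fin l → Fin m) → a [ σ ] [ τ ] ≡ a [ σ ∘ τ ]
[]-∘ a σ τ = tabulate-cong (lookup-[] a σ ∘ τ)

[]-id : (a : Vec Bool n) → a [ id ] ≡ a
[]-id = tabulate∘lookup

zipWith-[] : (_∙_ : Bool → Bool → Bool) (a b : Vec Bool n) (σ : Fin m → Fin n) →
             zipWith _∙_ a b [ σ ] ≡ zipWith _∙_ (a [ σ ]) (b [ σ ])
zipWith-[] _∙_ a b σ = vec-ext λ i → trans (lookup-[] (zipWith _∙_ a b) σ i)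
  (trans (lookup-zipWith _∙_ (σ i) a b)
  (trans (sym (cong₂ _∙_ (lookup-[] a σ i) (lookup-[] b σ i)))
         (sym (lookup-zipWith _∙_ i (a [ σ ]) (b [ σ ])))))

replicate-[] : (x : Bool) (σ : Fin m → Fin n) → replicate n x [ σ ] ≡ replicate m x
replicate-[] x σ = vec-ext λ i → trans (lookup-[] (replicate _ x) σ i)
  (trans (lookup-replicate (σ i) x) (sym (lookup-replicate i x)))

≗⇒≼ : {f g : Op n} → f ≗ g → f ≼ g
≗⇒≼ {g = g} f≗g = id , λ a → trans (f≗g a) (cong g (sym ([]-id a)))

≼-trans : {f : Op k} {g : Op m} {h : Op n} → f ≼ g → g ≼ h → f ≼ h
≼-trans {h = h} (σ , f≼) (τ , g≼) =
  σ ∘ τ , λ a → trans (f≼ a) (trans (g≼ (a [ σ ])) (cong h ([]-∘ a σ τ)))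

≈-sym : {f : Op m} {g : Op n} → f ≈ g → g ≈ f
≈-sym (p , q) = q , p

missed-value : k ℕ.< n → (h : Fin k → Fin n) → ∃[ z ] (∀ i → h i ≢ z)
missed-value {k} {n} k<n h =
  let z , ¬hit = ¬∀⟶∃¬ n (λ z → ∃[ i ] (h i ≡ z)) (λ z → any? (λ i → h i ≟ z)) ¬onto
  in z , λ i hi≡z → ¬hit (i , hi≡z)
  where
  ¬onto : ¬ (∀ z → ∃[ i ] (h i ≡ z))
  ¬onto onto =
    let z , w , z<w , eq = pigeonhole k<n (proj₁ ∘ onto)
    in <⇒≢ z<w (trans (sym (proj₂ (onto z))) (trans (cong h eq) (proj₂ (onto w))))

injective⇒surjective : n ≤ m → (σ : Fin m → Fin n) → Injective _≡_ _≡_ σ → ∀ q → ∃[ p ] (σ p ≡ q)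
injective⇒surjective {n} n≤m σ inj q with any? (λ p → σ p ≟ q)
... | yes hit = hit
injective⇒surjective {suc n} n<m σ inj q | no ¬hit =
  let i , j , i<j , eq = pigeonhole n<m (punchOut ∘ q≢σ)
  in contradiction (inj (punchOut-injective (q≢σ i) (q≢σ j) eq)) (<⇒≢ i<j)
  where
  q≢σ : ∀ p → q ≢ σ p
  q≢σ p q≡σp = ¬hit (p , sym q≡σp)

-- Identification minors

lo hi : TwoSubset (suc n) → Fin (suc n)
lo (j , i) = punchIn j (inject! i)
hi (j , i) = j

-- The quotient map that merges `hi I` into `lo I`; `ι I` is its section that misses `hi I`. A card
-- is then the minor along `κ I`, and insertions into tuples can be forgotten.
κ : TwoSubset (suc n) → Fin (suc n) → Fin n
κ (j , i) k with j ≟ k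
... | yes _  = inject! i
... | no j≢k = punchOut j≢k

ι : TwoSubset (suc n) → Fin n → Fin (suc n)
ι (j , _) = punchIn j

lo≢hi : (I : TwoSubset (suc n)) → lo I ≢ hi I
lo≢hi (j , i) = punchInᵢ≢i j (inject! i)

κ-punchIn : (I : TwoSubset (suc n)) (k : Fin n) → κ I (ι I k) ≡ k
κ-punchIn (j , i) k with j ≟ punchIn j k
... | yes j≡ = contradiction (sym j≡) (punchInᵢ≢i j k)
... | no _   = trans (punchOut-cong j refl) (punchOut-punchIn j)

κ-hi : (I : TwoSubset (suc n)) → κ I (hi I) ≡ κ I (lo I)
κ-hi I@(j , i) = trans helper (sym (κ-punchIn I (inject! i)))
  where
  helper : κ I j ≡ inject! i
  helper with j ≟ j
  ... | yes _  = refl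
  ... | no j≢j = contradiction refl j≢j

ι-κ : (I : TwoSubset (suc n)) (k : Fin (suc n)) → k ≢ hi I → ι I (κ I k) ≡ k
ι-κ (j , i) k k≢j with j ≟ k
... | yes j≡k = contradiction (sym j≡k) k≢j
... | no j≢k  = punchIn-punchOut j≢k

identify-κ : (f : Op (suc n)) (I : TwoSubset (suc n)) (b : Vec Bool n) → identify f I b ≡ f (b [ κ I ])
identify-κ f I@(j , i) b = cong f (vec-ext λ k → trans (entry k) (sym (lookup-[] b (κ I) k)))
  where
  x = lookup b (inject! i)
  entry : ∀ k → lookup (insertAt b j x) k ≡ lookup b (κ I k)
  entry k with j ≟ k
  ... | yes refl = insertAt-lookup b j x
  ... | no j≢k   = trans (cong (lookup (insertAt b j x)) (sym (punchIn-punchOut j≢k)))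
                         (insertAt-punchIn b j x (punchOut j≢k))

identify-≼ : (f : Op (suc n)) (I : TwoSubset (suc n)) → identify f I ≼ f
identify-≼ f I = κ I , identify-κ f I

κ-ι-restore : (I : TwoSubset (suc n)) (a : Vec Bool (suc n)) →
              lookup a (lo I) ≡ lookup a (hi I) → a [ ι I ] [ κ I ] ≡ a
κ-ι-restore I a eq = vec-ext λ k →
  trans (lookup-[] (a [ ι I ]) (κ I) k) (trans (lookup-[] a (ι I) (κ I k)) (entry k))
  where
  entry : ∀ k → lookup a (ι I (κ I k)) ≡ lookup a k
  entry k with k ≟ hi I
  ... | no k≢hi  = cong (lookup a) (ι-κ I k k≢hi)
  ... | yes refl = trans (cong (lookup a) (trans (cong (ι I) (κ-hi I)) (ι-κ I (lo I) (lo≢hi I)))) eq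

κ-injective-off : (I : TwoSubset (suc n)) {k p : Fin (suc n)} → p ≢ lo I → p ≢ hi I → κ I k ≡ κ I p → k ≡ p
κ-injective-off I {k} {p} p≢lo p≢hi eq with k ≟ hi I
... | no k≢hi  = trans (sym (ι-κ I k k≢hi)) (trans (cong (ι I) eq) (ι-κ I p p≢hi))
... | yes refl = contradiction
  (trans (sym (ι-κ I p p≢hi)) (trans (cong (ι I) (trans (sym eq) (κ-hi I))) (ι-κ I (lo I) (lo≢hi I)))) p≢lo

<⇒TwoSubset : (i j : Fin (suc n)) → i < j → ∃[ I ] (lo I ≡ i × hi I ≡ j)
<⇒TwoSubset {suc n} zero    (suc j) _         = (suc j , zero) , refl , refl
<⇒TwoSubset {suc n} (suc i) (suc j) (s≤s i<j) with <⇒TwoSubset i j i<j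
... | (j , i′) , refl , refl = (suc j , suc i′) , refl , refl

-- A `TwoSubset` comes ordered. This interface is symmetric in `i` and `j`, so that any two distinct
-- positions can be merged without comparing them.
record Identification {n} (i j : Fin (suc n)) : Set where
  field
    I         : TwoSubset (suc n)
    merges    : κ I i ≡ κ I j
    restores  : ∀ a → lookup a i ≡ lookup a j → a [ ι I ] [ κ I ] ≡ a
    separates : ∀ {k p} → p ≢ i → p ≢ j → κ I k ≡ κ I p → k ≡ p

  reads : (f : Op (suc n)) (a : Vec Bool (suc n)) → lookup a i ≡ lookup a j →
          f a ≡ identify f I (a [ ι I ])
  reads f a eq = trans (cong f (sym (restores a eq))) (sym (identify-κ f I (a [ ι I ])))

identification : {i j : Fin (suc n)} → i ≢ j → Identification i j
identification {i = i} {j} i≢j with <-cmp i j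
... | tri≈ _ i≡j _ = contradiction i≡j i≢j
... | tri< i<j _ _ with <⇒TwoSubset i j i<j
...   | I , refl , refl = record
  { I = I ; merges = sym (κ-hi I) ; restores = κ-ι-restore I ; separates = κ-injective-off I }
identification {i = i} {j} i≢j | tri> _ _ j<i with <⇒TwoSubset j i j<i
...   | I , refl , refl = record
  { I = I ; merges = κ-hi I ; restores = λ a eq → κ-ι-restore I a (sym eq)
  ; separates = λ p≢i p≢j → κ-injective-off I p≢j p≢i }

-- Laws inherited from identification minors

infixl 6 _⊕_
infixl 7 _⊓_

_⊓_ _⊕_ : Vec Bool n → Vec Bool n → Vec Bool n
_⊓_ = zipWith _∧_
_⊕_ = zipWith _xor_

𝟎 𝟏 : Vec Bool n
𝟎 = replicate _ false
𝟏 = replicate _ true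

-- A common format for the conditions f(a ∧ b) = f(a) ∧ f(b) and
-- f(a + b) + f(0) = f(a) + f(b).
Preserves : (Bool → Bool → Bool) → (Bool → Bool → Bool → Bool → Set) → Op n → Set
Preserves _∙_ Q f = ∀ a b → Q (f (zipWith _∙_ a b)) (f a) (f b) (f 𝟎)

PreservesColliding : (Bool → Bool → Bool) → (Bool → Bool → Bool → Bool → Set) → Op n → Set
PreservesColliding _∙_ Q f = ∀ {i j} → i ≢ j → ∀ a b → lookup a i ≡ lookup a j → lookup b i ≡ lookup b j →
                             Q (f (zipWith _∙_ a b)) (f a) (f b) (f 𝟎)

∧-Law ⊕-Law : Bool → Bool → Bool → Bool → Set
∧-Law r p q _ = r ≡ p ∧ q
⊕-Law r p q z = r xor z ≡ p xor q

Conjunctive Affine : Op n → Set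
Conjunctive = Preserves _∧_ ∧-Law
Affine      = Preserves _xor_ ⊕-Law

-- The condition at a pair (a , b) depends only on the columns (aᵢ , bᵢ).
-- Two equal columns reduce it to an identification minor; otherwise there
-- are exactly four columns, namely those of A₄ and B₄.

A₄ B₄ : Vec Bool 4
A₄ = true ∷ true ∷ false ∷ false ∷ []
B₄ = true ∷ false ∷ true ∷ false ∷ []

column : Bool → Bool → Fin 4
column true  true  = zero
column true  false = suc zero
column false true  = suc (suc zero)
column false false = suc (suc (suc zero))

A₄-column : ∀ x y → lookup A₄ (column x y) ≡ x
A₄-column true  true  = refl
A₄-column true  false = refl
A₄-column false true  = refl
A₄-column false false = refl

B₄-column : ∀ x y → lookup B₄ (column x y) ≡ y
B₄-column true  true  = refl
B₄-column true  false = refl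
B₄-column false true  = refl
B₄-column false false = refl

columns : Vec Bool n → Vec Bool n → Fin n → Fin 4
columns a b i = column (lookup a i) (lookup b i)

A₄-[columns] : (a b : Vec Bool n) → A₄ [ columns a b ] ≡ a
A₄-[columns] a b = vec-ext λ i → trans (lookup-[] A₄ (columns a b) i) (A₄-column (lookup a i) (lookup b i))

B₄-[columns] : (a b : Vec Bool n) → B₄ [ columns a b ] ≡ b
B₄-[columns] a b = vec-ext λ i → trans (lookup-[] B₄ (columns a b) i) (B₄-column (lookup a i) (lookup b i))

module _ {_∙_ : Bool → Bool → Bool} {Q : Bool → Bool → Bool → Bool → Set} where

  private
    QAt : Op n → Vec Bool n → Vec Bool n → Set
    QAt f a b = Q (f (zipWith _∙_ a b)) (f a) (f b) (f 𝟎)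

    QAt-cong : {f : Op m} {g : Op n} {a b : Vec Bool m} {c d : Vec Bool n} →
               f (zipWith _∙_ a b) ≡ g (zipWith _∙_ c d) → f a ≡ g c → f b ≡ g d → f 𝟎 ≡ g 𝟎 →
               QAt g c d → QAt f a b
    QAt-cong e₁ e₂ e₃ e₄ q rewrite e₁ | e₂ | e₃ | e₄ = q

    QAt-minor : {f : Op m} {g : Op n} (f≼g : f ≼ g) (a b : Vec Bool m) →
                QAt g (a [ proj₁ f≼g ]) (b [ proj₁ f≼g ]) → QAt f a b
    QAt-minor {f = f} {g} (σ , f≗g[σ]) a b = QAt-cong {f = f} {g}
      (trans (f≗g[σ] _) (cong g (zipWith-[] _∙_ a b σ))) (f≗g[σ] a) (f≗g[σ] b)
      (trans (f≗g[σ] 𝟎) (cong g (replicate-[] false σ)))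

  Preserves-≼ : {f : Op m} {g : Op n} → f ≼ g → Preserves _∙_ Q g → Preserves _∙_ Q f
  Preserves-≼ {f = f} {g} f≼g pres a b = QAt-minor {f = f} {g} f≼g a b (pres _ _)

  -- The tuples `a`, `b`, their combination and `𝟎` each have equal entries at `i` and `j`, so one
  -- and the same card shows all four values.
  colliding : (g : Op (suc n)) → (∀ I → Preserves _∙_ Q (identify g I)) → PreservesColliding _∙_ Q g
  colliding g minors {i} {j} i≢j a b aᵢ≡aⱼ bᵢ≡bⱼ = QAt-cong {f = g} {identify g I}
    (trans (reads g (zipWith _∙_ a b) (trans (lookup-zipWith _∙_ i a b)
      (trans (cong₂ _∙_ aᵢ≡aⱼ bᵢ≡bⱼ) (sym (lookup-zipWith _∙_ j a b)))))
      (cong (identify g I) (zipWith-[] _∙_ a b (ι I))))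
    (reads g a aᵢ≡aⱼ) (reads g b bᵢ≡bⱼ)
    (trans (reads g 𝟎 (trans (lookup-replicate i false) (sym (lookup-replicate j false))))
           (cong (identify g I) (replicate-[] false (ι I))))
    (minors I (a [ ι I ]) (b [ ι I ]))
    where open Identification (identification i≢j)

  module _ (base : (h : Op 4) → PreservesColliding _∙_ Q h → QAt h A₄ B₄) where

    recognition : 4 ≤ suc n → (g : Op (suc n)) → (∀ I → Preserves _∙_ Q (identify g I)) → Preserves _∙_ Q g
    recognition 4≤n g minors a b
      with any? (λ i → any? (λ j → ¬? (i ≟ j) ×-dec (columns a b i ≟ columns a b j)))
    ... | yes (i , j , i≢j , eq) = colliding g minors i≢j a b
      (trans (sym (A₄-column (lookup a i) (lookup b i))) (trans (cong (lookup A₄) eq) (A₄-column (lookup a j) (lookup b j))))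
      (trans (sym (B₄-column (lookup a i) (lookup b i))) (trans (cong (lookup B₄) eq) (B₄-column (lookup a j) (lookup b j))))
    ... | no noCollision = QAt-cong {f = g} {h} {c = A₄} {B₄}
      (cong g (trans (sym (cong₂ (zipWith _∙_) (A₄-[columns] a b) (B₄-[columns] a b))) (sym (zipWith-[] _∙_ A₄ B₄ σ))))
      (cong g (sym (A₄-[columns] a b))) (cong g (sym (B₄-[columns] a b)))
      (cong g (sym (replicate-[] false σ)))
      (base h hColliding)
      where
      σ : Fin _ → Fin 4
      σ = columns a b
      h : Op 4
      h c = g (c [ σ ])
      h≼g : h ≼ g
      h≼g = σ , λ _ → refl
      inj : ∀ {i j} → σ i ≡ σ j → i ≡ j
      inj {i} {j} eq = decidable-stable (i ≟ j) λ i≢j → noCollision (i , j , i≢j , eq)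
      -- Without equal columns `σ` is injective into four elements, so arity at least 4 makes it a
      -- bijection. Two positions of `h` then come from two positions of `g`, and collisions in `h`
      -- are collisions in `g`.
      onto = injective⇒surjective 4≤n σ inj
      hColliding : PreservesColliding _∙_ Q h
      hColliding {p} {q} p≢q c d cₚ≡c_q dₚ≡d_q with onto p | onto q
      ... | i , refl | j , refl = QAt-minor {f = h} {g} h≼g c d
        (colliding g minors (λ i≡j → p≢q (cong σ i≡j)) (c [ σ ]) (d [ σ ])
          (trans (lookup-[] c σ i) (trans cₚ≡c_q (sym (lookup-[] c σ j))))
          (trans (lookup-[] d σ i) (trans dₚ≡d_q (sym (lookup-[] d σ j)))))

pattern #0 = zero
pattern #1 = suc zero
pattern #2 = suc (suc zero)
pattern #3 = suc (suc (suc zero))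

conjunctive-recognition : 4 ≤ suc n → (g : Op (suc n)) → (∀ I → Conjunctive (identify g I)) → Conjunctive g
conjunctive-recognition = recognition {_∧_} {∧-Law} base
  where
  base : (h : Op 4) → PreservesColliding _∧_ ∧-Law h →
         h (true ∷ false ∷ false ∷ false ∷ []) ≡
         h (true ∷ true ∷ false ∷ false ∷ []) ∧ h (true ∷ false ∷ true ∷ false ∷ [])
  -- Any two of the tuples 1110, 1101, 1011 collide, and so do 1110 and 1001. Both sides thus become
  -- the meet of the values at those three tuples.
  base h coll
    rewrite coll {#1} {#2} (λ ()) (true ∷ true ∷ true ∷ false ∷ []) (true ∷ false ∷ false ∷ true ∷ []) refl refl
          | coll {#0} {#1} (λ ()) (true ∷ true ∷ true ∷ false ∷ []) (true ∷ true ∷ false ∷ true ∷ []) refl refl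
          | coll {#0} {#2} (λ ()) (true ∷ true ∷ true ∷ false ∷ []) (true ∷ false ∷ true ∷ true ∷ []) refl refl
          | coll {#0} {#3} (λ ()) (true ∷ true ∷ false ∷ true ∷ []) (true ∷ false ∷ true ∷ true ∷ []) refl refl
    = absorb (h (true ∷ true ∷ true ∷ false ∷ [])) _ _
    where
    absorb : ∀ x y z → x ∧ (y ∧ z) ≡ (x ∧ y) ∧ (x ∧ z)
    absorb true  y     z = refl
    absorb false y     z = refl

-- In the sum of the first two equations `x` and `z` occur twice and cancel, which leaves y + w = p
-- + q.
⊕-combine : ∀ p q r z x y w → p xor z ≡ x xor y → q xor z ≡ x xor w → r xor z ≡ y xor w → r xor z ≡ p xor q
⊕-combine p q r z x y w e₁ e₂ e₃ =
  trans e₃ (trans (step x y w) (trans (cong₂ _xor_ (sym e₁) (sym e₂)) (drop p q z)))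
  where
  step : ∀ x y w → y xor w ≡ (x xor y) xor (x xor w)
  step true  true  true  = refl
  step true  true  false = refl
  step true  false true  = refl
  step true  false false = refl
  step false y     w     = refl
  drop : ∀ p q z → (p xor z) xor (q xor z) ≡ p xor q
  drop true  true  true  = refl
  drop true  true  false = refl
  drop true  false true  = refl
  drop true  false false = refl
  drop false true  true  = refl
  drop false true  false = refl
  drop false false true  = refl
  drop false false false = refl

affine-recognition : 4 ≤ suc n → (g : Op (suc n)) → (∀ I → Affine (identify g I)) → Affine g
affine-recognition = recognition {_xor_} {⊕-Law} base
  where
  base : (h : Op 4) → PreservesColliding _xor_ ⊕-Law h →
         h (false ∷ true ∷ true ∷ false ∷ []) xor h 𝟎 ≡
         h (true ∷ true ∷ false ∷ false ∷ []) xor h (true ∷ false ∷ true ∷ false ∷ [])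
  base h coll = ⊕-combine
    (h (true ∷ true ∷ false ∷ false ∷ [])) (h (true ∷ false ∷ true ∷ false ∷ [])) (h (false ∷ true ∷ true ∷ false ∷ [])) (h 𝟎)
    (h (true ∷ false ∷ false ∷ false ∷ [])) (h (false ∷ true ∷ false ∷ false ∷ [])) (h (false ∷ false ∷ true ∷ false ∷ []))
    (coll {#2} {#3} (λ ()) (true ∷ false ∷ false ∷ false ∷ []) (false ∷ true ∷ false ∷ false ∷ []) refl refl)
    (coll {#1} {#3} (λ ()) (true ∷ false ∷ false ∷ false ∷ []) (false ∷ false ∷ true ∷ false ∷ []) refl refl)
    (coll {#0} {#3} (λ ()) (false ∷ true ∷ false ∷ false ∷ []) (false ∷ false ∷ true ∷ false ∷ []) refl refl)

-- Polynomial operations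

weaken : Polynomial n → Polynomial (suc n)
weaken (var i)   = var (suc i)
weaken (const b) = const b
weaken (s · t)   = weaken s · weaken t

⟦weaken⟧ : (_∙_ : Bool → Bool → Bool) (t : Polynomial n) (x : Bool) (a : Vec Bool n) →
           ⟦ weaken t ⟧ _∙_ (x ∷ a) ≡ ⟦ t ⟧ _∙_ a
⟦weaken⟧ _∙_ (var i)   x a = refl
⟦weaken⟧ _∙_ (const b) x a = refl
⟦weaken⟧ _∙_ (s · t)   x a = cong₂ _∙_ (⟦weaken⟧ _∙_ s x a) (⟦weaken⟧ _∙_ t x a)

polynomial⇒conjunctive : (t : Polynomial n) → Conjunctive (⟦ t ⟧ _∧_)
polynomial⇒conjunctive (var i)       a b = lookup-zipWith _∧_ i a b
polynomial⇒conjunctive (const true)  a b = refl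
polynomial⇒conjunctive (const false) a b = refl
polynomial⇒conjunctive (s · t)       a b
  rewrite polynomial⇒conjunctive s a b | polynomial⇒conjunctive t a b =
  interchange (⟦ s ⟧ _∧_ a) (⟦ s ⟧ _∧_ b) _ _
  where
  interchange : ∀ p q r u → (p ∧ q) ∧ (r ∧ u) ≡ (p ∧ r) ∧ (q ∧ u)
  interchange true  true  r u = refl
  interchange true  false r u = sym (∧-zeroʳ r)
  interchange false q     r u = refl

polynomial⇒affine : (t : Polynomial n) → Affine (⟦ t ⟧ _xor_)
polynomial⇒affine (var i) a b
  rewrite lookup-zipWith _xor_ i a b | lookup-replicate i false = xor-false _
  where
  xor-false : ∀ x → x xor false ≡ x
  xor-false true  = refl
  xor-false false = refl
polynomial⇒affine (const true)  a b = refl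
polynomial⇒affine (const false) a b = refl
polynomial⇒affine (s · t) a b =
  interchange (⟦ s ⟧ _xor_ (a ⊕ b)) (⟦ s ⟧ _xor_ a) (⟦ s ⟧ _xor_ b) (⟦ s ⟧ _xor_ 𝟎)
    (⟦ t ⟧ _xor_ (a ⊕ b)) (⟦ t ⟧ _xor_ a) (⟦ t ⟧ _xor_ b) (⟦ t ⟧ _xor_ 𝟎)
    (polynomial⇒affine s a b) (polynomial⇒affine t a b)
  where
  open import Data.Bool.Properties using (xor-∧-commutativeRing)
  open import Algebra.Bundles using (CommutativeRing)
  open import Algebra.Properties.CommutativeSemigroup
    (CommutativeRing.+-commutativeSemigroup xor-∧-commutativeRing) renaming (interchange to xor-interchange)
  interchange : ∀ r p q z r′ p′ q′ z′ → r xor z ≡ p xor q → r′ xor z′ ≡ p′ xor q′ →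
                (r xor r′) xor (z xor z′) ≡ (p xor p′) xor (q xor q′)
  interchange r p q z r′ p′ q′ z′ e e′ =
    trans (xor-interchange r r′ z z′) (trans (cong₂ _xor_ e e′) (xor-interchange p q p′ q′))

conjunctive⇒polynomial : (f : Op n) → Conjunctive f → ∃[ t ] f ≗ ⟦ t ⟧ _∧_
conjunctive⇒polynomial {zero}  f _    = const (f []) , λ { [] → refl }
conjunctive⇒polynomial {suc n} f conj
  with conjunctive⇒polynomial (f ∘ (true ∷_)) (λ a b → conj (true ∷ a) (true ∷ b))
... | t , f₁≗t with f (false ∷ 𝟏) in eq
... | true  = weaken t , λ { (true ∷ a)  → trans (f₁≗t a) (sym (⟦weaken⟧ _∧_ t true a))
                           ; (false ∷ a) → trans (lower a) (trans (f₁≗t a) (sym (⟦weaken⟧ _∧_ t false a))) }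
  where
  lower : ∀ a → f (false ∷ a) ≡ f (true ∷ a)
  lower a = trans (cong (f ∘ (false ∷_)) (vec-ext λ i → sym (trans (lookup-zipWith _∧_ i 𝟏 a) (cong (_∧ lookup a i) (lookup-replicate i true)))))
            (trans (conj (false ∷ 𝟏) (true ∷ a)) (cong (_∧ f (true ∷ a)) eq))
... | false = var zero · weaken t , λ { (true ∷ a)  → trans (f₁≗t a) (sym (⟦weaken⟧ _∧_ t true a))
                                      ; (false ∷ a) → lower a }
  where
  lower : ∀ a → f (false ∷ a) ≡ false
  lower a = trans (cong (f ∘ (false ∷_)) (vec-ext λ i → sym (trans (lookup-zipWith _∧_ i 𝟏 a) (cong (_∧ lookup a i) (lookup-replicate i true)))))
            (trans (conj (false ∷ 𝟏) (true ∷ a)) (cong (_∧ f (true ∷ a)) eq))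

-- Raising the first argument adds the constant `f (true ∷ 𝟎) xor f (false ∷ 𝟎)`, whatever the other
-- arguments are.
affine⇒polynomial : (f : Op n) → Affine f → ∃[ t ] f ≗ ⟦ t ⟧ _xor_
affine⇒polynomial {zero}  f _   = const (f []) , λ { [] → refl }
affine⇒polynomial {suc n} f aff
  with affine⇒polynomial (f ∘ (false ∷_)) (λ a b → aff (false ∷ a) (false ∷ b))
... | t , f₀≗t = add (f (true ∷ 𝟎) xor f (false ∷ 𝟎)) (λ a → shift (f (true ∷ a)) (f (true ∷ 𝟎)) (f (false ∷ a)) (f 𝟎)
    (trans (cong (λ b → f (true ∷ b) xor f 𝟎) (sym (𝟎-⊕ a))) (aff (true ∷ 𝟎) (false ∷ a))))
  where
  𝟎-⊕ : (a : Vec Bool n) → 𝟎 ⊕ a ≡ a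
  𝟎-⊕ a = vec-ext λ i → trans (lookup-zipWith _xor_ i 𝟎 a) (cong (_xor lookup a i) (lookup-replicate i false))
  shift : ∀ p q r z → p xor z ≡ q xor r → p ≡ (q xor z) xor r
  shift true  true  r     true  e = trans (cong not e) (not-involutive r)
  shift true  false r     true  e = cong not e
  shift true  true  r     false e = e
  shift true  false r     false e = e
  shift false true  r     true  e = trans (cong not e) (not-involutive r)
  shift false false r     true  e = cong not e
  shift false true  r     false e = e
  shift false false r     false e = e
  add : ∀ c → (∀ a → f (true ∷ a) ≡ c xor f (false ∷ a)) → ∃[ t′ ] f ≗ ⟦ t′ ⟧ _xor_
  add true  f₁ = var zero · weaken t , λ
    { (true  ∷ a) → trans (f₁ a) (cong not (trans (f₀≗t a) (sym (⟦weaken⟧ _xor_ t true a))))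
    ; (false ∷ a) → trans (f₀≗t a) (sym (⟦weaken⟧ _xor_ t false a)) }
  add false f₁ = weaken t , λ
    { (true  ∷ a) → trans (f₁ a) (trans (f₀≗t a) (sym (⟦weaken⟧ _xor_ t true a)))
    ; (false ∷ a) → trans (f₀≗t a) (sym (⟦weaken⟧ _xor_ t false a)) }

-- Reconstruction of conjunctions and affine functions

_agrees_off_ : Vec Bool n → Vec Bool n → Fin n → Set
a agrees b off p = ∀ k → k ≢ p → lookup a k ≡ lookup b k

Inessential Sensitive : Op n → Fin n → Set
Inessential f p = ∀ a b → a agrees b off p → f a ≡ f b
Sensitive   f p = ∀ a b → a agrees b off p → lookup a p ≢ lookup b p → f a ≡ not (f b)

splice : Fin n → Vec Bool n → Vec Bool n → Vec Bool n
splice p a b = tabulate λ k → if does (k ≟ p) then lookup a k else lookup b k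

splice-at : (p : Fin n) (a b : Vec Bool n) → lookup (splice p a b) p ≡ lookup a p
splice-at p a b = trans (lookup∘tabulate _ p)
  (cong (λ t → if t then lookup a p else lookup b p) (dec-true (p ≟ p) refl))

splice-off : (p : Fin n) (a b : Vec Bool n) → splice p a b agrees b off p
splice-off p a b k k≢p = trans (lookup∘tabulate _ k)
  (cong (λ t → if t then lookup a k else lookup b k) (dec-false (k ≟ p) k≢p))

eq-off : {a b : Vec Bool n} {p : Fin n} → a agrees b off p → lookup a p ≡ lookup b p → a ≡ b
eq-off {p = p} off at = vec-ext entry
  where
  entry : ∀ k → _
  entry k with k ≟ p
  ... | yes refl = at
  ... | no k≢p   = off k k≢p

others : (p : Fin (suc (suc n))) → ∃[ q ] (q ≢ p)
others zero    = suc zero , λ ()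
others (suc p) = zero , λ ()

avoid₂ : 3 ≤ n → (p q : Fin n) → ∃[ r ] (r ≢ p × r ≢ q)
avoid₂ 3≤n p q with missed-value 3≤n (λ { zero → p ; (suc zero) → q })
... | r , r∉ = r , (λ r≡p → r∉ zero (sym r≡p)) , λ r≡q → r∉ (suc zero) (sym r≡q)

avoid₃ : 4 ≤ n → (p q r : Fin n) → ∃[ s ] (s ≢ p × s ≢ q × s ≢ r)
avoid₃ 4≤n p q r with missed-value 4≤n (λ { zero → p ; (suc zero) → q ; (suc (suc zero)) → r })
... | s , s∉ = s , (λ s≡p → s∉ zero (sym s≡p)) , (λ s≡q → s∉ (suc zero) (sym s≡q)) , λ s≡r → s∉ (suc (suc zero)) (sym s≡r)

Hypomorphic-sym : {f g : Op (suc n)} → Hypomorphic f g → Hypomorphic g f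
Hypomorphic-sym {f = f} {g} (π , match) = ↔-sym π , λ I →
  ≈-sym {f = identify f (from I)} {identify g I} (subst (λ J → identify f (from I) ≈ identify g J) (Inverse.strictlyInverseˡ π I) (match (from I)))
  where open Inverse π using (from)

hypomorphic-card : {f g : Op (suc n)} → Hypomorphic f g → ∀ J → ∃[ I ] (identify f I ≈ identify g J)
hypomorphic-card {f = f} {g} (π , match) J = from J ,
  subst (λ K → identify f (from J) ≈ identify g K) (Inverse.strictlyInverseˡ π J) (match (from J))
  where open Inverse π using (from)

-- Overwriting the entry at `p` by the entry at another position `q` does not affect `f`, and the
-- resulting tuples are among those seen by the card that merges `q` and `p`.
inessential⇒card : (f : Op (suc (suc n))) {p : Fin (suc (suc n))} → Inessential f p → ∃[ I ] (f ≼ identify f I)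
inessential⇒card f {p} iness = I , θ ∘ ι I , λ a →
  trans (iness a (a [ θ ]) (λ k k≢p → trans (cong (lookup a) (sym (θ-off k≢p))) (sym (lookup-[] a θ k))))
  (trans (reads f (a [ θ ]) (trans (lookup-[] a θ q)
      (trans (cong (lookup a) (trans (θ-off q≢p) (sym θ-at))) (sym (lookup-[] a θ p)))))
    (cong (identify f I) ([]-∘ a θ (ι I))))
  where
  q   = proj₁ (others p)
  q≢p = proj₂ (others p)
  open Identification (identification q≢p)
  θ : Fin _ → Fin _
  θ k = if does (k ≟ p) then q else k
  θ-at : θ p ≡ q
  θ-at rewrite dec-true (p ≟ p) refl = refl
  θ-off : ∀ {k} → k ≢ p → θ k ≡ k
  θ-off {k} k≢p rewrite dec-false (k ≟ p) k≢p = refl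

inessential⇒≼ : {f g : Op (suc (suc n))} {p : Fin (suc (suc n))} → Inessential f p → Hypomorphic f g → f ≼ g
inessential⇒≼ {f = f} {g} iness (π , match) =
  let I , f≼f_I = inessential⇒card f iness
  in ≼-trans {f = f} {identify f I} {g} f≼f_I
     (≼-trans {f = identify f I} {identify g (Inverse.to π I)} {g} (proj₁ (match I)) (identify-≼ g _))

module _ {i j : Fin (suc n)} (i≢j : i ≢ j) where
  open Identification (identification i≢j)

  inessential-identify : (g : Op (suc n)) {p : Fin (suc n)} → p ≢ i → p ≢ j →
                         Inessential g p → Inessential (identify g I) (κ I p)
  inessential-identify g {p} p≢i p≢j iness a b off =
    trans (identify-κ g I a) (trans (iness _ _ off′) (sym (identify-κ g I b)))
    where
    off′ : (a [ κ I ]) agrees (b [ κ I ]) off p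
    off′ k k≢p = trans (lookup-[] a (κ I) k)
      (trans (off (κ I k) (k≢p ∘ separates p≢i p≢j)) (sym (lookup-[] b (κ I) k)))

  -- Changing the merged argument changes two sensitive arguments at once.
  merged-inessential : (g : Op (suc n)) → Sensitive g i → Sensitive g j → Inessential (identify g I) (κ I i)
  merged-inessential g sensᵢ sensⱼ a b off with lookup a (κ I i) ≟ᵇ lookup b (κ I i)
  ... | yes eq = cong (identify g I) (eq-off off eq)
  ... | no neq = trans (identify-κ g I a) (trans twice (sym (identify-κ g I b)))
    where
    a′ = a [ κ I ]
    b′ = b [ κ I ]
    c  = splice i b′ a′
    aᵢ≢bᵢ : lookup a′ i ≢ lookup b′ i
    aᵢ≢bᵢ eq = neq (trans (sym (lookup-[] a (κ I) i)) (trans eq (lookup-[] b (κ I) i)))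
    aⱼ≢bⱼ : lookup a′ j ≢ lookup b′ j
    aⱼ≢bⱼ eq = neq (trans (cong (lookup a) merges) (trans (sym (lookup-[] a (κ I) j))
      (trans eq (trans (lookup-[] b (κ I) j) (cong (lookup b) (sym merges))))))
    c-off-j : c agrees b′ off j
    c-off-j k k≢j with k ≟ i
    ... | yes refl = splice-at i b′ a′
    ... | no k≢i   = trans (splice-off i b′ a′ k k≢i) (trans (lookup-[] a (κ I) k)
      (trans (off (κ I k) (λ eq → k≢i (sym (separates k≢i k≢j (sym eq))))) (sym (lookup-[] b (κ I) k))))
    twice : g a′ ≡ g b′
    twice = trans (sensᵢ a′ c (λ k k≢i → sym (splice-off i b′ a′ k k≢i))
                     (λ eq → aᵢ≢bᵢ (trans eq (splice-at i b′ a′))))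
      (trans (cong not (sensⱼ c b′ c-off-j (λ eq → aⱼ≢bⱼ (trans (sym (splice-off i b′ a′ j (≢-sym i≢j))) eq))))
             (not-involutive (g b′)))

-- The positions of `g` other than `p` are too few to be mapped onto all arguments of `f`. An
-- argument that they miss can enter `g` only through `p`.
inessential-≼ : {f g : Op (suc n)} {p : Fin (suc n)} → f ≼ g → Inessential g p → ∃[ q ] Inessential f q
inessential-≼ {p = p} (σ , f≗) iness with missed-value (n<1+n _) (σ ∘ punchIn p)
... | q , missed = q , λ a b off → trans (f≗ a) (trans (iness _ _ λ k k≢p → trans (lookup-[] a σ k)
    (trans (off (σ k) (λ σk≡q → missed (punchOut (≢-sym k≢p)) (trans (cong σ (punchIn-punchOut (≢-sym k≢p))) σk≡q)))
           (sym (lookup-[] b σ k)))) (sym (f≗ b)))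

inessential₂-≼ : {f g : Op (suc n)} {p₁ p₂ : Fin (suc n)} → f ≼ g → p₁ ≢ p₂ →
                 Inessential g p₁ → Inessential g p₂ →
                 ∃₂ λ q₁ q₂ → q₁ ≢ q₂ × Inessential f q₁ × Inessential f q₂
inessential₂-≼ {f = f} {g} {p₁} {p₂} (σ , f≗) p₁≢p₂ iness₁ iness₂ =
  q₁ , q₂ , q₁≢q₂ , both (λ {k} k≢p₁ _ → hit₁ k≢p₁) , both hit₂
  where
  first = missed-value (n<1+n _) (σ ∘ punchIn p₁)
  q₁ = proj₁ first
  missed₁ = proj₂ first
  -- Redirecting `p₂` to `q₁` before the second search forces the second missed value to differ from
  -- the first.
  τ : Fin _ → Fin _
  τ k = if does (k ≟ p₂) then q₁ else σ k
  second = missed-value (n<1+n _) (τ ∘ punchIn p₁)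
  q₂ = proj₁ second
  missed₂ = proj₂ second
  hit₁ : ∀ {k} → k ≢ p₁ → σ k ≢ q₁
  hit₁ k≢p₁ eq = missed₁ (punchOut (≢-sym k≢p₁)) (trans (cong σ (punchIn-punchOut (≢-sym k≢p₁))) eq)
  hitτ : ∀ {k} → k ≢ p₁ → τ k ≢ q₂
  hitτ k≢p₁ eq = missed₂ (punchOut (≢-sym k≢p₁)) (trans (cong τ (punchIn-punchOut (≢-sym k≢p₁))) eq)
  q₁≢q₂ : q₁ ≢ q₂
  q₁≢q₂ eq = hitτ {p₂} (≢-sym p₁≢p₂)
    (trans (cong (λ t → if t then q₁ else σ p₂) (dec-true (p₂ ≟ p₂) refl)) eq)
  hit₂ : ∀ {k} → k ≢ p₁ → k ≢ p₂ → σ k ≢ q₂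
  hit₂ {k} k≢p₁ k≢p₂ eq = hitτ k≢p₁
    (trans (cong (λ t → if t then q₁ else σ k) (dec-false (k ≟ p₂) k≢p₂)) eq)
  both : ∀ {q} → (∀ {k} → k ≢ p₁ → k ≢ p₂ → σ k ≢ q) → Inessential f q
  both hit a b off = trans (f≗ a) (trans
    (trans (iness₁ _ (splice p₁ (b [ σ ]) (a [ σ ])) λ k k≢p₁ → sym (splice-off p₁ (b [ σ ]) (a [ σ ]) k k≢p₁))
           (iness₂ _ (b [ σ ]) off₂)) (sym (f≗ b)))
    where
    off₂ : splice p₁ (b [ σ ]) (a [ σ ]) agrees (b [ σ ]) off p₂
    off₂ k k≢p₂ with k ≟ p₁
    ... | yes refl = splice-at p₁ (b [ σ ]) (a [ σ ])
    ... | no k≢p₁  = trans (splice-off p₁ (b [ σ ]) (a [ σ ]) k k≢p₁) (trans (lookup-[] a σ k)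
      (trans (off (σ k) (hit k≢p₁ k≢p₂)) (sym (lookup-[] b σ k))))

allBut single : Fin n → Vec Bool n
allBut p = splice p 𝟎 𝟏
single p = splice p 𝟏 𝟎

allBut-at : (p : Fin n) → lookup (allBut p) p ≡ false
allBut-at p = trans (splice-at p 𝟎 𝟏) (lookup-replicate p false)

allBut-off : (p : Fin n) {k : Fin n} → k ≢ p → lookup (allBut p) k ≡ true
allBut-off p {k} k≢p = trans (splice-off p 𝟎 𝟏 k k≢p) (lookup-replicate k true)

single-at : (p : Fin n) → lookup (single p) p ≡ true
single-at p = trans (splice-at p 𝟏 𝟎) (lookup-replicate p true)

single-off : (p : Fin n) {k : Fin n} → k ≢ p → lookup (single p) k ≡ false
single-off p {k} k≢p = trans (splice-off p 𝟏 𝟎 k k≢p) (lookup-replicate k false)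

module _ {f : Op (suc n)} (conj : Conjunctive f) (full : ∀ p → ¬ Inessential f p) where

  full-conjunction-𝟏 : f 𝟏 ≡ true
  full-conjunction-𝟏 with f 𝟏 in eq
  ... | true  = refl
  ... | false = contradiction (λ a b _ → trans (zero-on a) (sym (zero-on b))) (full zero)
    where
    zero-on : ∀ a → f a ≡ false
    zero-on a = trans (cong f (vec-ext λ i → sym (trans (lookup-zipWith _∧_ i 𝟏 a) (cong (_∧ lookup a i) (lookup-replicate i true)))))
      (trans (conj 𝟏 a) (cong (_∧ f a) eq))

  -- Otherwise `f a` equals `f (allBut p ⊓ a)` for every `a`, and the latter does not see argument
  -- `p`.
  full-conjunction-allBut : ∀ p → f (allBut p) ≡ false
  full-conjunction-allBut p with f (allBut p) in eq
  ... | false = refl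
  ... | true  = contradiction (λ a b off → trans (mask a) (trans (cong f (masked a b off)) (sym (mask b)))) (full p)
    where
    mask : ∀ a → f a ≡ f (allBut p ⊓ a)
    mask a = sym (trans (conj (allBut p) a) (cong (_∧ f a) eq))
    masked : ∀ a b → a agrees b off p → allBut p ⊓ a ≡ allBut p ⊓ b
    masked a b off = vec-ext λ k → trans (lookup-zipWith _∧_ k (allBut p) a)
      (trans (entry k) (sym (lookup-zipWith _∧_ k (allBut p) b)))
      where
      entry : ∀ k → lookup (allBut p) k ∧ lookup a k ≡ lookup (allBut p) k ∧ lookup b k
      entry k with k ≟ p
      ... | yes refl rewrite allBut-at p = refl
      ... | no k≢p   = cong (_ ∧_) (off k k≢p)

  full-conjunction-false : ∀ a p → lookup a p ≡ false → f a ≡ false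
  full-conjunction-false a p aₚ≡false =
    trans (cong f (vec-ext λ k → sym (trans (lookup-zipWith _∧_ k a (allBut p)) (entry k))))
    (trans (conj a (allBut p)) (trans (cong (f a ∧_) (full-conjunction-allBut p)) (∧-zeroʳ (f a))))
    where
    entry : ∀ k → lookup a k ∧ lookup (allBut p) k ≡ lookup a k
    entry k with k ≟ p
    ... | yes refl rewrite aₚ≡false = refl
    ... | no k≢p   = trans (cong (_ ∧_) (allBut-off p k≢p)) (∧-identityʳ _)

  -- By now `f` is known to be the conjunction of all its arguments, and so is each of its cards:
  -- `𝟏` and `allBut q` tell the two values of argument `q` apart.
  full-conjunction-card : ∀ I q → ¬ Inessential (identify f I) q
  full-conjunction-card I q iness = contradiction
    (trans (sym onTrue) (trans (iness 𝟏 (allBut q) λ k k≢q → trans (lookup-replicate k true) (sym (allBut-off q k≢q))) onFalse))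
    λ ()
    where
    onTrue : identify f I 𝟏 ≡ true
    onTrue = trans (identify-κ f I 𝟏) (trans (cong f (replicate-[] true (κ I))) full-conjunction-𝟏)
    onFalse : identify f I (allBut q) ≡ false
    onFalse = trans (identify-κ f I (allBut q)) (full-conjunction-false _ (ι I q)
      (trans (lookup-[] (allBut q) (κ I) (ι I q)) (trans (cong (lookup (allBut q)) (κ-punchIn I q)) (allBut-at q))))

full-conjunctions-agree : {f g : Op (suc n)} → Conjunctive f → Conjunctive g →
  (∀ p → ¬ Inessential f p) → (∀ p → ¬ Inessential g p) → f ≗ g
full-conjunctions-agree {f = f} {g} conj-f conj-g full-f full-g a with any? (λ k → lookup a k ≟ᵇ false)
... | yes (k , aₖ≡false) = trans (full-conjunction-false conj-f full-f a k aₖ≡false)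
                                 (sym (full-conjunction-false conj-g full-g a k aₖ≡false))
... | no none = trans (cong f a≡𝟏) (trans (full-conjunction-𝟏 conj-f full-f)
                  (trans (sym (full-conjunction-𝟏 conj-g full-g)) (cong g (sym a≡𝟏))))
  where
  a≡𝟏 : a ≡ 𝟏
  a≡𝟏 = vec-ext λ k → trans (¬-not (λ aₖ → none (k , aₖ))) (sym (lookup-replicate k true))

-- Adding `single p` to any tuple changes an affine `f` by the same constant `f (single p) xor f 𝟎`.
-- So an argument matters either always or never.
affine-sensitive : {f : Op n} → Affine f → ∀ p → ¬ Inessential f p → Sensitive f p
affine-sensitive {f = f} aff p ess a b off aₚ≢bₚ with f (single p) ≟ᵇ f 𝟎
... | no neq = flip (f (single p)) (f 𝟎) (f b) neq (trans (cong (λ c → f c xor f 𝟎) a≡) (aff (single p) b))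
  where
  a≡ : a ≡ single p ⊕ b
  a≡ = vec-ext λ k → trans (entry k) (sym (lookup-zipWith _xor_ k (single p) b))
    where
    entry : ∀ k → lookup a k ≡ lookup (single p) k xor lookup b k
    entry k with k ≟ p
    ... | yes refl rewrite single-at p = ¬-not aₚ≢bₚ
    ... | no k≢p   rewrite single-off p k≢p = off k k≢p
  flip : ∀ {r} x z y → x ≢ z → r xor z ≡ x xor y → r ≡ not y
  flip {true}  true  true  y x≢z e = contradiction refl x≢z
  flip {true}  true  false y x≢z e = e
  flip {true}  false true  y x≢z e = cong not e
  flip {true}  false false y x≢z e = contradiction refl x≢z
  flip {false} true  true  y x≢z e = contradiction refl x≢z
  flip {false} true  false y x≢z e = e
  flip {false} false true  y x≢z e = cong not e
  flip {false} false false y x≢z e = contradiction refl x≢z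
... | yes eq = contradiction iness ess
  where
  shift : ∀ {r} z y → r xor z ≡ z xor y → r ≡ y
  shift {true}  true  false ()
  shift {true}  true  true  e = refl
  shift {true}  false y e = e
  shift {false} true  false e = refl
  shift {false} true  true  ()
  shift {false} false y e = e
  iness : Inessential f p
  iness c d off′ with lookup c p ≟ᵇ lookup d p
  ... | yes at = cong f (eq-off off′ at)
  ... | no neq = shift (f 𝟎) (f d) (trans (cong (λ v → f v xor f 𝟎) c≡) (trans (aff (single p) d) (cong (_xor f d) eq)))
    where
    c≡ : c ≡ single p ⊕ d
    c≡ = vec-ext λ k → trans (entry k) (sym (lookup-zipWith _xor_ k (single p) d))
      where
      entry : ∀ k → lookup c k ≡ lookup (single p) k xor lookup d k
      entry k with k ≟ p
      ... | yes refl rewrite single-at p = ¬-not neq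
      ... | no k≢p   rewrite single-off p k≢p = off′ k k≢p

sensitive-agree : {f g : Op n} → (∀ p → Sensitive f p) → (∀ p → Sensitive g p) → f 𝟎 ≡ g 𝟎 → f ≗ g
sensitive-agree sens-f sens-g eq [] = eq
sensitive-agree {f = f} {g} sens-f sens-g eq (x ∷ a) = go x
  where
  tail-sensitive : ∀ {h : Op _} → (∀ p → Sensitive h p) → ∀ p → Sensitive (h ∘ (false ∷_)) p
  tail-sensitive sens p c d off = sens (suc p) (false ∷ c) (false ∷ d)
    λ { zero _ → refl ; (suc k) k≢p → off k (k≢p ∘ cong suc) }
  lower : f (false ∷ a) ≡ g (false ∷ a)
  lower = sensitive-agree (tail-sensitive sens-f) (tail-sensitive sens-g) eq a
  raise : ∀ {h : Op _} → (∀ p → Sensitive h p) → h (true ∷ a) ≡ not (h (false ∷ a))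
  raise sens = sens zero (true ∷ a) (false ∷ a) (λ { zero 0≢0 → contradiction refl 0≢0 ; (suc k) _ → refl }) λ ()
  go : ∀ x → f (x ∷ a) ≡ g (x ∷ a)
  go false = lower
  go true  = trans (raise sens-f) (trans (cong not lower) (sym (raise sens-g)))

-- An argument of the card other than the merged one stands for exactly one argument of `f`, so
-- changing it alone changes the value.
sensitive-card : {f : Op (suc n)} → (∀ p → Sensitive f p) → ∀ I q → Inessential (identify f I) q → q ≡ κ I (lo I)
sensitive-card {f = f} sens I q iness with q ≟ κ I (lo I)
... | yes eq = eq
... | no neq = contradiction changes (not-¬ (sym (iness 𝟎 (single q) (λ k k≢q → trans (lookup-replicate k false) (sym (single-off q k≢q))))))
  where
  r = ι I q
  κr≡q : κ I r ≡ q
  κr≡q = κ-punchIn I q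
  r≢lo : r ≢ lo I
  r≢lo r≡lo = neq (trans (sym κr≡q) (cong (κ I) r≡lo))
  r≢hi : r ≢ hi I
  r≢hi = punchInᵢ≢i (hi I) q
  off : (𝟎 [ κ I ]) agrees (single q [ κ I ]) off r
  off k k≢r = trans (lookup-[] 𝟎 (κ I) k) (trans (lookup-replicate (κ I k) false) (sym (trans (lookup-[] (single q) (κ I) k)
    (single-off q λ κk≡q → k≢r (κ-injective-off I r≢lo r≢hi (trans κk≡q (sym κr≡q)))))))
  at : lookup (𝟎 [ κ I ]) r ≢ lookup (single q [ κ I ]) r
  at eq = contradiction (trans (sym (trans (lookup-[] 𝟎 (κ I) r) (lookup-replicate (κ I r) false)))
    (trans eq (trans (lookup-[] (single q) (κ I) r) (trans (cong (lookup (single q)) κr≡q) (single-at q))))) λ ()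
  changes : identify f I (single q) ≡ not (identify f I 𝟎)
  changes = trans (identify-κ f I (single q)) (trans (sens r _ _ (λ k k≢r → sym (off k k≢r)) (at ∘ sym))
    (cong not (sym (identify-κ f I 𝟎))))

ExcludedMiddle₀ : Set₁
ExcludedMiddle₀ = (P : Set) → Dec P

-- Merging two arguments of `g` other than `p` leaves `p` inessential, but no card of `f` has an
-- inessential argument.
conjunctive-mixed : 4 ≤ suc (suc n) → {f g : Op (suc (suc n))} → Conjunctive f → (∀ p → ¬ Inessential f p) →
                    ∀ {p} → Inessential g p → ¬ Hypomorphic f g
conjunctive-mixed 4≤n {f} {g} conj full {p} iness hyp =
  let i , i≢p , _   = avoid₂ (≤-trans (n≤1+n 3) 4≤n) p p
      j , j≢p , j≢i = avoid₂ (≤-trans (n≤1+n 3) 4≤n) p i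
      i≢j = ≢-sym j≢i
      J   = Identification.I (identification i≢j)
      I , f_I≼g_J , _ = hypomorphic-card {f = f} {g} hyp J
      q , iness-q = inessential-≼ {f = identify f I} {identify g J} f_I≼g_J
                      (inessential-identify i≢j g (≢-sym i≢p) (≢-sym j≢p) iness)
  in full-conjunction-card conj full I q iness-q

-- A card of `f` has at most one inessential argument, the merged one. It suffices to find a card of
-- `g` with two. If `g` has a second inessential argument, both survive the merging of two others,
-- which takes arity 4. If not, `p` survives and two merged sensitive arguments cancel.
affine-mixed : ExcludedMiddle₀ → 4 ≤ suc (suc n) → {f g : Op (suc (suc n))} → (∀ p → Sensitive f p) → Affine g →
               ∀ {p} → Inessential g p → ¬ Hypomorphic f g
affine-mixed em 4≤n {f} {g} sens aff {p} iness hyp =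
  let J , q₁ , q₂ , q₁≢q₂ , iness₁ , iness₂ = twoInessential (em _)
      I , f_I≼g_J , _ = hypomorphic-card {f = f} {g} hyp J
      r₁ , r₂ , r₁≢r₂ , iness₁′ , iness₂′ = inessential₂-≼ {f = identify f I} {identify g J} f_I≼g_J q₁≢q₂ iness₁ iness₂
  in r₁≢r₂ (trans (sensitive-card sens I r₁ iness₁′) (sym (sensitive-card sens I r₂ iness₂′)))
  where
  3≤n = ≤-trans (n≤1+n 3) 4≤n
  twoInessential : Dec (∃[ q ] (q ≢ p × Inessential g q)) →
    ∃[ J ] ∃[ q₁ ] ∃[ q₂ ] (q₁ ≢ q₂ × Inessential (identify g J) q₁ × Inessential (identify g J) q₂)
  twoInessential (yes (q , q≢p , iness-q)) =
    let i , i≢p , i≢q       = avoid₂ 3≤n p q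
        j , j≢p , j≢q , j≢i = avoid₃ 4≤n p q i
        i≢j = ≢-sym j≢i
        open Identification (identification i≢j)
    in I , κ I q , κ I p , (λ eq → q≢p (separates (≢-sym i≢p) (≢-sym j≢p) eq))
     , inessential-identify i≢j g (≢-sym i≢q) (≢-sym j≢q) iness-q
     , inessential-identify i≢j g (≢-sym i≢p) (≢-sym j≢p) iness
  twoInessential (no none) =
    let i , i≢p , _   = avoid₂ 3≤n p p
        j , j≢p , j≢i = avoid₂ 3≤n p i
        i≢j = ≢-sym j≢i
        open Identification (identification i≢j)
        sens-g : ∀ q → q ≢ p → Sensitive g q
        sens-g q q≢p = affine-sensitive aff q λ iness-q → none (q , q≢p , iness-q)
    in I , κ I i , κ I p , (λ eq → i≢p (separates (≢-sym i≢p) (≢-sym j≢p) eq))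
     , merged-inessential i≢j g (sens-g i i≢p) (sens-g j j≢p)
     , inessential-identify i≢j g (≢-sym i≢p) (≢-sym j≢p) iness

-- Every card takes the value `f 𝟎` at its zero tuple. This is the one datum by which affine
-- functions without inessential arguments can differ.
hypomorphic-𝟎 : {f g : Op (suc (suc n))} → Hypomorphic f g → f 𝟎 ≡ g 𝟎
hypomorphic-𝟎 {f = f} {g} (π , match) =
  let I = suc zero , zero
      J = Inverse.to π I
      (σ , f_I≗) , _ = match I
  in trans (sym (at𝟎 f I)) (trans (f_I≗ 𝟎) (trans (cong (identify g J) (replicate-[] false σ)) (at𝟎 g J)))
  where
  at𝟎 : (f : Op (suc (suc _))) (I : TwoSubset _) → identify f I 𝟎 ≡ f 𝟎
  at𝟎 f I = trans (identify-κ f I 𝟎) (cong f (replicate-[] false (κ I)))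

preserves-reconstruction : (_∙_ : Bool → Bool → Bool) (Q : Bool → Bool → Bool → Bool → Set) {f g : Op (suc n)} →
  Preserves _∙_ Q f → Hypomorphic f g → ∀ J → Preserves _∙_ Q (identify g J)
preserves-reconstruction _∙_ Q {f} {g} pres hyp J =
  let I , _ , g_J≼f_I = hypomorphic-card {f = f} {g} hyp J
  in Preserves-≼ {_∙_} {Q} {f = identify g J} {identify f I} g_J≼f_I (Preserves-≼ {_∙_} {Q} {f = identify f I} {f} (identify-≼ f I) pres)

module _ (em : ExcludedMiddle₀) where

  reconstruct : (P : ∀ {n} → Op (suc n) → Set) →
    (∀ {n} {f g : Op (suc n)} → 4 ≤ suc n → P f → Hypomorphic f g → P g) →
    (∀ {n} {f g : Op (suc (suc n))} → 4 ≤ suc (suc n) → P f → P g → (∀ p → ¬ Inessential f p) → (∀ p → ¬ Inessential g p) →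
       Hypomorphic f g → f ≗ g) →
    (∀ {n} {f g : Op (suc (suc n))} → 4 ≤ suc (suc n) → P f → P g → (∀ p → ¬ Inessential f p) → ∀ {p} → Inessential g p → ¬ Hypomorphic f g) →
    ∀ {n} {f : Op (suc n)} → P f → 4 ≤ suc n → ReconstructibleFunction f
  reconstruct P recognise full-agree mixed {zero} Pf (s≤s ())
  reconstruct P recognise full-agree mixed {suc n} {f} Pf 4≤n g hyp =
    cases (em (∃[ p ] Inessential f p)) (em (∃[ p ] Inessential g p))
    where
    Pg = recognise {f = f} {g} 4≤n Pf hyp
    hyp⁻¹ = Hypomorphic-sym {f = f} {g} hyp
    cases : Dec (∃[ p ] Inessential f p) → Dec (∃[ p ] Inessential g p) → f ≈ g
    cases (yes (p , iness-f)) (yes (q , iness-g)) =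
      inessential⇒≼ {f = f} {g} iness-f hyp , inessential⇒≼ {f = g} {f} iness-g hyp⁻¹
    cases (yes (p , iness-f)) (no full-g) =
      contradiction hyp⁻¹ (mixed {f = g} {f} 4≤n Pg Pf (λ q iness → full-g (q , iness)) iness-f)
    cases (no full-f) (yes (q , iness-g)) =
      contradiction hyp (mixed {f = f} {g} 4≤n Pf Pg (λ p iness → full-f (p , iness)) iness-g)
    cases (no full-f) (no full-g) =
      let f≗g = full-agree {f = f} {g} 4≤n Pf Pg (λ p iness → full-f (p , iness)) (λ p iness → full-g (p , iness)) hyp
      in ≗⇒≼ f≗g , ≗⇒≼ (sym ∘ f≗g)

  conjunctive-reconstructible : {f : Op (suc n)} → Conjunctive f → 4 ≤ suc n → ReconstructibleFunction f
  conjunctive-reconstructible = reconstruct Conjunctive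
    (λ {_} {f} {g} 4≤n conj hyp → conjunctive-recognition 4≤n g (preserves-reconstruction _∧_ ∧-Law {f} {g} conj hyp))
    (λ _ conj-f conj-g full-f full-g _ → full-conjunctions-agree conj-f conj-g full-f full-g)
    (λ 4≤n conj-f _ full iness → conjunctive-mixed 4≤n conj-f full iness)

  affine-reconstructible : {f : Op (suc n)} → Affine f → 4 ≤ suc n → ReconstructibleFunction f
  affine-reconstructible = reconstruct Affine
    (λ {_} {f} {g} 4≤n aff hyp → affine-recognition 4≤n g (preserves-reconstruction _xor_ ⊕-Law {f} {g} aff hyp))
    (λ {_} {f} {g} 4≤n aff-f aff-g full-f full-g hyp → sensitive-agree
       (λ p → affine-sensitive aff-f p (full-f p)) (λ p → affine-sensitive aff-g p (full-g p))
       (hypomorphic-𝟎 {f = f} {g} hyp))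
    (λ {_} {f} {g} 4≤n aff-f aff-g full iness → affine-mixed em 4≤n {f} {g} (λ p → affine-sensitive aff-f p (full p)) aff-g iness)

-- Duality

dual : Op n → Op n
dual f a = not (f (map not a))

map-not-involutive : (a : Vec Bool n) → map not (map not a) ≡ a
map-not-involutive a = vec-ext λ i → trans (lookup-map i not (map not a))
  (trans (cong not (lookup-map i not a)) (not-involutive _))

map-[] : (a : Vec Bool n) (σ : Fin m → Fin n) → map not (a [ σ ]) ≡ map not a [ σ ]
map-[] a σ = vec-ext λ i → trans (lookup-map i not (a [ σ ])) (trans (cong not (lookup-[] a σ i))
  (sym (trans (lookup-[] (map not a) σ i) (lookup-map (σ i) not a))))

dual-involutive : (f : Op n) → dual (dual f) ≗ f
dual-involutive f a = trans (not-involutive _) (cong f (map-not-involutive a))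

dual-≼ : {f : Op m} {g : Op n} → f ≼ g → dual f ≼ dual g
dual-≼ {g = g} (σ , f≗) = σ , λ a → cong not (trans (f≗ (map not a)) (cong g (sym (map-[] a σ))))

dual-≈ : {f : Op m} {g : Op n} → f ≈ g → dual f ≈ dual g
dual-≈ {f = f} {g} (p , q) = dual-≼ {f = f} {g} p , dual-≼ {f = g} {f} q

≗⇒≈ : {f g : Op n} → f ≗ g → f ≈ g
≗⇒≈ f≗g = ≗⇒≼ f≗g , ≗⇒≼ (sym ∘ f≗g)

≈-trans : {f : Op k} {g : Op m} {h : Op n} → f ≈ g → g ≈ h → f ≈ h
≈-trans {f = f} {g} {h} (p , q) (r , s) = ≼-trans {f = f} {g} {h} p r , ≼-trans {f = h} {g} {f} s q

dual-≈⁻¹ : {f : Op m} {g : Op n} → dual f ≈ dual g → f ≈ g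
dual-≈⁻¹ {f = f} {g} eq = ≈-trans {f = f} {dual (dual f)} {g} (≗⇒≈ (sym ∘ dual-involutive f))
  (≈-trans {f = dual (dual f)} {dual (dual g)} {g} (dual-≈ {f = dual f} {dual g} eq) (≗⇒≈ (dual-involutive g)))

identify-dual : (f : Op (suc n)) (I : TwoSubset (suc n)) → identify (dual f) I ≗ dual (identify f I)
identify-dual f I a = trans (identify-κ (dual f) I a)
  (cong not (trans (cong f (map-[] a (κ I))) (sym (identify-κ f I (map not a)))))

dual-card : {f g : Op (suc n)} (I J : TwoSubset (suc n)) → identify f I ≈ identify g J → identify (dual f) I ≈ identify (dual g) J
dual-card {f = f} {g} I J eq = ≈-trans {f = identify (dual f) I} {dual (identify f I)} {identify (dual g) J} (≗⇒≈ (identify-dual f I))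
  (≈-trans {f = dual (identify f I)} {dual (identify g J)} {identify (dual g) J}
    (dual-≈ {f = identify f I} {identify g J} eq) (≗⇒≈ (sym ∘ identify-dual g J)))

-- Dualising commutes with identification, so the same bijection `π` matches the decks of the duals.
dual-reconstructible : {f : Op (suc n)} → ReconstructibleFunction (dual f) → ReconstructibleFunction f
dual-reconstructible {f = f} rec g (π , match) = dual-≈⁻¹ {f = f} {g}
  (rec (dual g) (π , λ I → dual-card {f = f} {g} I (Inverse.to π I) (match I)))

dualPolynomial : Polynomial n → Polynomial n
dualPolynomial (var i)   = var i
dualPolynomial (const b) = const (not b)
dualPolynomial (s · t)   = dualPolynomial s · dualPolynomial t

⟦dualPolynomial⟧ : {_∙_ _∙′_ : Bool → Bool → Bool} → (∀ x y → not (x ∙ y) ≡ not x ∙′ not y) →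
                   (t : Polynomial n) → dual (⟦ t ⟧ _∙_) ≗ ⟦ dualPolynomial t ⟧ _∙′_
⟦dualPolynomial⟧ deMorgan (var i)   a = trans (cong not (lookup-map i not a)) (not-involutive _)
⟦dualPolynomial⟧ deMorgan (const b) a = refl
⟦dualPolynomial⟧ {_∙′_ = _∙′_} deMorgan (s · t) a =
  trans (deMorgan _ _) (cong₂ _∙′_ (⟦dualPolynomial⟧ deMorgan s a) (⟦dualPolynomial⟧ deMorgan t a))

dual-cong : {f g : Op n} → f ≗ g → dual f ≗ dual g
dual-cong f≗g a = cong not (f≗g (map not a))

V⇒dual-Λ : {f : Op (suc n)} → f ∈ V → dual f ∈ Λ
V⇒dual-Λ (t , f≗t) = dualPolynomial t , λ a → trans (dual-cong f≗t a)
  (⟦dualPolynomial⟧ (λ { true _ → refl ; false _ → refl }) t a)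

dual-Λ⇒V : {f : Op (suc n)} → dual f ∈ Λ → f ∈ V
dual-Λ⇒V {f = f} (t , f≗t) = dualPolynomial t , λ a → trans (sym (dual-involutive f a)) (trans (dual-cong f≗t a)
  (⟦dualPolynomial⟧ (λ { true _ → refl ; false _ → refl }) t a))

Λ⇒conjunctive : {f : Op (suc n)} → f ∈ Λ → Conjunctive f
Λ⇒conjunctive {f = f} (t , f≗t) = Preserves-≼ {_∧_} {∧-Law} {f = f} {⟦ t ⟧ _∧_} (≗⇒≼ f≗t) (polynomial⇒conjunctive t)

L⇒affine : {f : Op (suc n)} → f ∈ L → Affine f
L⇒affine {f = f} (t , f≗t) = Preserves-≼ {_xor_} {⊕-Law} {f = f} {⟦ t ⟧ _xor_} (≗⇒≼ f≗t) (polynomial⇒affine t)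

module _ (em : ExcludedMiddle₀) where

  Λ-reconstructible : Reconstructible (Λ ^≥ 4)
  Λ-reconstructible f (f∈Λ , 4≤n) = conjunctive-reconstructible em (Λ⇒conjunctive {f = f} f∈Λ) 4≤n

  V-reconstructible : Reconstructible (V ^≥ 4)
  V-reconstructible f (f∈V , 4≤n) = dual-reconstructible {f = f} (Λ-reconstructible (dual f) (V⇒dual-Λ {f = f} f∈V , 4≤n))

  L-reconstructible : Reconstructible (L ^≥ 4)
  L-reconstructible f (f∈L , 4≤n) = affine-reconstructible em (L⇒affine {f = f} f∈L) 4≤n

-- Generating the minimal clones outside Λ, V and L

all? : {P : Vec Bool n → Set} → Decidable P → Dec (∀ v → P v)
all? {zero}  P? = map′ (λ { p [] → p }) (λ p → p []) (P? [])
all? {suc n} P? = map′ (λ { (p , q) (true ∷ v) → p v ; (p , q) (false ∷ v) → q v })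
                       (λ p → p ∘ (true ∷_) , p ∘ (false ∷_))
                       (all? (P? ∘ (true ∷_)) ×-dec all? (P? ∘ (false ∷_)))

_≗?_ : (f g : Op n) → Dec (f ≗ g)
f ≗? g = all? λ v → f v ≟ᵇ g v

ternary : (Bool → Bool → Bool → Bool) → Op 3
ternary h (x ∷ y ∷ z ∷ []) = h x y z

meet join majority meetJoin : Bool → Bool → Bool → Bool
meet     x y z = x ∧ y
join     x y z = x ∨ y
majority x y z = if x then y ∨ z else y ∧ z
meetJoin x y z = x ∧ (y ∨ z)

data Term (n : ℕ) : Set where
  var     : Fin n → Term n
  ⟨_,_,_⟩ : Term n → Term n → Term n → Term n

eval : Op 3 → Term n → Op n
eval g (var i)       a = lookup a i
eval g ⟨ r , s , t ⟩ a = g (eval g r a ∷ eval g s a ∷ eval g t a ∷ [])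

eval-cong : {g h : Op 3} → g ≗ h → (t : Term n) → eval g t ≗ eval h t
eval-cong g≗h (var i) a = refl
eval-cong {g = g} {h} g≗h ⟨ r , s , t ⟩ a
  rewrite eval-cong g≗h r a | eval-cong g≗h s a | eval-cong g≗h t a = g≗h _

table₂ : Vec Bool 4 → Bool → Bool → Bool
table₂ (p ∷ q ∷ r ∷ s ∷ []) x y = if x then (if y then s else r) else (if y then q else p)

table₃ : Vec Bool 8 → Op 3
table₃ (p ∷ q ∷ r ∷ s ∷ t ∷ u ∷ v ∷ w ∷ []) =
  ternary λ x y z → if x then table₂ (t ∷ u ∷ v ∷ w ∷ []) y z else table₂ (p ∷ q ∷ r ∷ s ∷ []) y z

NonaffineAt : Op 3 → Set
NonaffineAt g = g (true ∷ true ∷ false ∷ []) xor g 𝟎 ≢ g (true ∷ false ∷ false ∷ []) xor g (false ∷ true ∷ false ∷ [])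

nonaffineAt? : (g : Op 3) → Dec (NonaffineAt g)
nonaffineAt? g = ¬? (g (true ∷ true ∷ false ∷ []) xor g 𝟎 ≟ᵇ g (true ∷ false ∷ false ∷ []) xor g (false ∷ true ∷ false ∷ []))

-- Found by computer search, as are guardedTerms below.
nonaffineTerms : List (Term 3)
nonaffineTerms =
  ⟨ ⟨ x , x , y ⟩ , ⟨ y , y , x ⟩ , ⟨ x , x , y ⟩ ⟩ ∷
  ⟨ x , y , ⟨ y , y , y ⟩ ⟩ ∷
  ⟨ x , ⟨ x , y , y ⟩ , ⟨ z , z , z ⟩ ⟩ ∷
  ⟨ ⟨ x , y , x ⟩ , y , ⟨ x , y , y ⟩ ⟩ ∷
  ⟨ x , y , ⟨ y , y , x ⟩ ⟩ ∷
  ⟨ ⟨ x , y , y ⟩ , ⟨ y , x , x ⟩ , ⟨ x , y , z ⟩ ⟩ ∷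
  ⟨ x , ⟨ x , y , x ⟩ , x ⟩ ∷
  ⟨ ⟨ x , x , x ⟩ , y , x ⟩ ∷
  ⟨ ⟨ x , x , z ⟩ , ⟨ z , x , y ⟩ , y ⟩ ∷
  ⟨ ⟨ x , y , z ⟩ , y , z ⟩ ∷
  ⟨ ⟨ x , x , x ⟩ , y , ⟨ x , x , z ⟩ ⟩ ∷ []
  where
  x y z : Term 3
  x = var zero
  y = var (suc zero)
  z = var (suc (suc zero))

abstract
  -- Decided by running through all 256 ternary operations; `abstract` prevents later unfolding of
  -- this computation.
  nonaffine-generates : ∀ t → NonaffineAt (table₃ t) →
    Any (λ r → eval (table₃ t) r ≗ ternary meet ⊎ eval (table₃ t) r ≗ ternary join ⊎ eval (table₃ t) r ≗ ternary majority) nonaffineTerms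
  nonaffine-generates = from-yes (all? λ t → nonaffineAt? (table₃ t) →-dec anyList?
    (λ r → (eval (table₃ t) r ≗? ternary meet) ⊎-dec (eval (table₃ t) r ≗? ternary join) ⊎-dec (eval (table₃ t) r ≗? ternary majority))
    nonaffineTerms)

guarded : Vec Bool 4 → Op 3
guarded t = ternary λ x y z → x ∧ table₂ t y z

guardedTerms : List (Term 3)
guardedTerms =
  ⟨ x , ⟨ x , y , z ⟩ , ⟨ z , y , x ⟩ ⟩ ∷
  ⟨ x , y , ⟨ z , x , y ⟩ ⟩ ∷
  ⟨ x , y , ⟨ x , y , z ⟩ ⟩ ∷
  ⟨ x , ⟨ ⟨ x , y , y ⟩ , z , z ⟩ , ⟨ ⟨ x , y , y ⟩ , z , z ⟩ ⟩ ∷ []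
  where
  x y z : Term 3
  x = var zero
  y = var (suc zero)
  z = var (suc (suc zero))

abstract
  guarded-generates : ∀ t → table₂ t false false ≢ table₂ t true false ∧ table₂ t false true →
    Any (λ r → eval (guarded t) r ≗ ternary meetJoin) guardedTerms
  guarded-generates = from-yes (all? λ t → ¬? (table₂ t false false ≟ᵇ table₂ t true false ∧ table₂ t false true) →-dec
    anyList? (λ r → eval (guarded t) r ≗? ternary meetJoin) guardedTerms)

Dual : Class ℓ → Class ℓ
Dual C f = dual f ∈ C

dual-isClone : {C : Class ℓ} → IsClone C → IsClone (Dual C)
dual-isClone {C = C} isClone = record
  { resp-≗      = λ {_} {f} {g} f≗g → resp-≗ {f = dual f} {dual g} (dual-cong f≗g)
  ; projection  = λ i → resp-≗ (λ a → sym (trans (cong not (lookup-map i not a)) (not-involutive _))) (projection i)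
  ; composition = λ f g f∈ g∈ → resp-≗
      (λ a → cong (not ∘ f) (vec-ext λ i → trans (lookup-map i not (Data.Vec.Base.tabulate λ j → dual (g j) a))
        (trans (cong not (lookup∘tabulate (λ j → dual (g j) a) i)) (trans (not-involutive _)
          (sym (lookup∘tabulate (λ j → g j (map not a)) i))))))
      (composition (dual f) (dual ∘ g) f∈ g∈)
  }
  where
  open IsClone isClone
  open import Data.Vec.Properties using (lookup-map; lookup∘tabulate)

module Generation {ℓ} {C : Class ℓ} (isClone : IsClone C) where
  open IsClone isClone

  minor-closed : {f : Op (suc m)} → f ∈ C → (σ : Fin (suc m) → Fin (suc n)) → (λ a → f (a [ σ ])) ∈ C
  minor-closed {f = f} f∈C σ = composition f (λ i a → lookup a (σ i)) f∈C (projection ∘ σ)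

  ternary-closed : {g : Op 3} → g ∈ C → {f₀ f₁ f₂ : Op (suc n)} → f₀ ∈ C → f₁ ∈ C → f₂ ∈ C →
                   (λ a → g (f₀ a ∷ f₁ a ∷ f₂ a ∷ [])) ∈ C
  ternary-closed {n = n} {g} g∈C {f₀} {f₁} {f₂} f₀∈C f₁∈C f₂∈C = composition g args g∈C args∈C
    where
    args : Fin 3 → Op (suc n)
    args zero             = f₀
    args (suc zero)       = f₁
    args (suc (suc zero)) = f₂
    args∈C : ∀ i → args i ∈ C
    args∈C zero             = f₀∈C
    args∈C (suc zero)       = f₁∈C
    args∈C (suc (suc zero)) = f₂∈C

  eval-∈ : {g : Op 3} → g ∈ C → (t : Term (suc n)) → eval g t ∈ C
  eval-∈ g∈C (var i)       = projection i
  eval-∈ {g = g} g∈C ⟨ r , s , t ⟩ = ternary-closed {g = g} g∈C {eval g r} {eval g s} {eval g t} (eval-∈ g∈C r) (eval-∈ g∈C s) (eval-∈ g∈C t)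

  nonaffine⇒ : {g : Op 3} → g ∈ C → NonaffineAt g →
               ternary meet ∈ C ⊎ ternary join ∈ C ⊎ ternary majority ∈ C
  nonaffine⇒ {g} g∈C nonaff = done (proj₂ found)
    where
    t : Vec Bool 8
    t = g (false ∷ false ∷ false ∷ []) ∷ g (false ∷ false ∷ true ∷ []) ∷
        g (false ∷ true ∷ false ∷ []) ∷ g (false ∷ true ∷ true ∷ []) ∷
        g (true ∷ false ∷ false ∷ []) ∷ g (true ∷ false ∷ true ∷ []) ∷
        g (true ∷ true ∷ false ∷ []) ∷ g (true ∷ true ∷ true ∷ []) ∷ []
    found = satisfied (nonaffine-generates t nonaff)
    r = proj₁ found
    g≗ : g ≗ table₃ t
    g≗ (true  ∷ true  ∷ true  ∷ []) = refl
    g≗ (true  ∷ true  ∷ false ∷ []) = refl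
    g≗ (true  ∷ false ∷ true  ∷ []) = refl
    g≗ (true  ∷ false ∷ false ∷ []) = refl
    g≗ (false ∷ true  ∷ true  ∷ []) = refl
    g≗ (false ∷ true  ∷ false ∷ []) = refl
    g≗ (false ∷ false ∷ true  ∷ []) = refl
    g≗ (false ∷ false ∷ false ∷ []) = refl
    table∈C : eval (table₃ t) r ∈ C
    table∈C = eval-∈ (resp-≗ g≗ g∈C) r
    done : eval (table₃ t) r ≗ ternary meet ⊎ eval (table₃ t) r ≗ ternary join ⊎ eval (table₃ t) r ≗ ternary majority →
           ternary meet ∈ C ⊎ ternary join ∈ C ⊎ ternary majority ∈ C
    done (inj₁ e)        = inj₁ (resp-≗ e table∈C)
    done (inj₂ (inj₁ e)) = inj₂ (inj₁ (resp-≗ e table∈C))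
    done (inj₂ (inj₂ e)) = inj₂ (inj₂ (resp-≗ e table∈C))

  -- F(0110) + F(1100) + F(1010) + F(0000) is the sum of the corresponding
  -- expressions for three ternary minors.
  nonaffine-op⇒ : {f : Op (suc n)} → f ∈ C → (a b : Vec Bool (suc n)) → ¬ (f (a ⊕ b) xor f 𝟎 ≡ f a xor f b) →
                  ternary meet ∈ C ⊎ ternary join ∈ C ⊎ ternary majority ∈ C
  nonaffine-op⇒ {f = f} f∈C a b violated = search
    (nonaffineAt? (minor σ₁)) (nonaffineAt? (minor σ₂)) (nonaffineAt? (minor σ₃))
    where
    F : Op 4
    F c = f (c [ columns a b ])
    σ₁ σ₂ σ₃ : Fin 4 → Fin 3
    -- In each minor the last variable stands for the constant 0, which `C` may lack: `NonaffineAt`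
    -- only looks at tuples where it is 0.
    σ₁ = lookup (#2 ∷ #0 ∷ #1 ∷ #2 ∷ [])
    σ₂ = lookup (#0 ∷ #1 ∷ #2 ∷ #2 ∷ [])
    σ₃ = lookup (#0 ∷ #2 ∷ #1 ∷ #2 ∷ [])
    minor : (Fin 4 → Fin 3) → Op 3
    minor σ c = F (c [ σ ])
    minor∈C : ∀ σ → minor σ ∈ C
    minor∈C = minor-closed {f = F} (minor-closed {f = f} f∈C (columns a b))
    F-violated : F (false ∷ true ∷ true ∷ false ∷ []) xor F 𝟎 ≢ F A₄ xor F B₄
    F-violated eq = violated (trans (cong₂ _xor_
      (cong f (trans (sym (cong₂ _⊕_ (A₄-[columns] a b) (B₄-[columns] a b))) (sym (zipWith-[] _xor_ A₄ B₄ (columns a b)))))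
      (cong f (sym (replicate-[] false (columns a b)))))
      (trans eq (cong₂ _xor_ (cong f (A₄-[columns] a b)) (cong f (B₄-[columns] a b)))))
    search : Dec (NonaffineAt (minor σ₁)) → Dec (NonaffineAt (minor σ₂)) → Dec (NonaffineAt (minor σ₃)) →
             ternary meet ∈ C ⊎ ternary join ∈ C ⊎ ternary majority ∈ C
    search (yes p) _ _ = nonaffine⇒ (minor∈C σ₁) p
    search _ (yes p) _ = nonaffine⇒ (minor∈C σ₂) p
    search _ _ (yes p) = nonaffine⇒ (minor∈C σ₃) p
    search (no p) (no q) (no r) = contradiction
      (⊕-combine (F A₄) (F B₄) (F (false ∷ true ∷ true ∷ false ∷ [])) (F 𝟎)
        (F (true ∷ false ∷ false ∷ false ∷ [])) (F (false ∷ true ∷ false ∷ false ∷ [])) (F (false ∷ false ∷ true ∷ false ∷ []))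
        (decidable-stable (_ ≟ᵇ _) q) (decidable-stable (_ ≟ᵇ _) r) (decidable-stable (_ ≟ᵇ _) p))
      F-violated

  nonconjunctive-op⇒ : ternary meet ∈ C → {f : Op (suc n)} → f ∈ C → (a b : Vec Bool (suc n)) →
                       ¬ (f (a ⊓ b) ≡ f a ∧ f b) → ternary meetJoin ∈ C
  nonconjunctive-op⇒ meet∈C {f} f∈C a b violated =
    let r , e = satisfied (guarded-generates t F-violated)
    in resp-≗ e (eval-∈ (resp-≗ K≗ K∈C) r)
    where
    F : Op 4
    F c = f (c [ columns a b ])
    F-violated : F (true ∷ false ∷ false ∷ false ∷ []) ≢ F A₄ ∧ F B₄
    F-violated eq = violated (trans
      (cong f (trans (sym (cong₂ _⊓_ (A₄-[columns] a b) (B₄-[columns] a b))) (sym (zipWith-[] _∧_ A₄ B₄ (columns a b)))))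
      (trans eq (cong₂ _∧_ (cong f (A₄-[columns] a b)) (cong f (B₄-[columns] a b)))))
    t : Vec Bool 4
    t = F (true ∷ false ∷ false ∷ false ∷ []) ∷ F (true ∷ false ∷ true ∷ false ∷ []) ∷
        F (true ∷ true ∷ false ∷ false ∷ []) ∷ F (true ∷ true ∷ true ∷ true ∷ []) ∷ []
    x y z : Op 3
    x v = lookup v zero
    y v = lookup v (suc zero)
    z v = lookup v (suc (suc zero))
    _⋏_ : Op 3 → Op 3 → Op 3
    (g ⋏ h) v = g v ∧ h v
    ⋏-∈ : {g h : Op 3} → g ∈ C → h ∈ C → (g ⋏ h) ∈ C
    ⋏-∈ {g} {h} g∈C h∈C = ternary-closed {g = ternary meet} meet∈C {g} {h} {h} g∈C h∈C h∈C
    args : Fin 4 → Op 3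
    args #0 = x
    args #1 = x ⋏ y
    args #2 = x ⋏ z
    args #3 = x ⋏ (y ⋏ z)
    args∈C : ∀ i → args i ∈ C
    args∈C #0 = projection zero
    args∈C #1 = ⋏-∈ {x} {y} (projection _) (projection _)
    args∈C #2 = ⋏-∈ {x} {z} (projection _) (projection _)
    args∈C #3 = ⋏-∈ {x} {y ⋏ z} (projection _) (⋏-∈ {y} {z} (projection _) (projection _))
    -- Constants may be missing from `C`. Under the guard `x`, the column (1 , 1) is filled by `x`
    -- itself, and the column (0 , 0) by the meet of all three variables, which is 0 at the three
    -- tuples involved in the violation.
    K : Op 3
    K = x ⋏ (λ v → F (x v ∷ (x ⋏ y) v ∷ (x ⋏ z) v ∷ (x ⋏ (y ⋏ z)) v ∷ []))
    K∈C : K ∈ C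
    K∈C = ⋏-∈ {x} {λ v → F (x v ∷ (x ⋏ y) v ∷ (x ⋏ z) v ∷ (x ⋏ (y ⋏ z)) v ∷ [])} (projection zero)
      (composition F args (minor-closed {f = f} f∈C (columns a b)) args∈C)
    K≗ : K ≗ guarded t
    K≗ (true  ∷ true  ∷ true  ∷ []) = refl
    K≗ (true  ∷ true  ∷ false ∷ []) = refl
    K≗ (true  ∷ false ∷ true  ∷ []) = refl
    K≗ (true  ∷ false ∷ false ∷ []) = refl
    K≗ (false ∷ true  ∷ true  ∷ []) = refl
    K≗ (false ∷ true  ∷ false ∷ []) = refl
    K≗ (false ∷ false ∷ true  ∷ []) = refl
    K≗ (false ∷ false ∷ false ∷ []) = refl

lower-em : ExcludedMiddle ℓ → ExcludedMiddle₀
lower-em em P = map′ unlift lift em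

module _ (em : ExcludedMiddle ℓ) {C : Class ℓ} where

  nonmember : (D : Class 0ℓ) → ¬ (C ⊑ D) → Σ[ n ∈ ℕ ] Σ[ f ∈ Op (suc n) ] (f ∈ C × ¬ (f ∈ D))
  nonmember D C⋢D = decidable-stable em λ none → C⋢D λ f f∈C → decidable-stable (lower-em em _) λ f∉D → none (_ , f , f∈C , f∉D)

  module _ (isClone : IsClone C) where
    open Generation isClone

    ⋢L⇒ : ¬ (C ⊑ L) → ternary meet ∈ C ⊎ ternary join ∈ C ⊎ ternary majority ∈ C
    ⋢L⇒ C⋢L =
      let n , f , f∈C , f∉L = nonmember L C⋢L
          a , b , violated = decidable-stable (lower-em em (∃[ a ] ∃[ b ] ¬ (f (a ⊕ b) xor f 𝟎 ≡ f a xor f b)))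
            λ none → f∉L (affine⇒polynomial f λ a b → decidable-stable (_ ≟ᵇ _) λ v → none (a , b , v))
      in nonaffine-op⇒ {f = f} f∈C a b violated

    ⋢Λ⇒ : ternary meet ∈ C → ¬ (C ⊑ Λ) → ternary meetJoin ∈ C
    ⋢Λ⇒ meet∈C C⋢Λ =
      let n , f , f∈C , f∉Λ = nonmember Λ C⋢Λ
          a , b , violated = decidable-stable (lower-em em (∃[ a ] ∃[ b ] ¬ (f (a ⊓ b) ≡ f a ∧ f b)))
            λ none → f∉Λ (conjunctive⇒polynomial f λ a b → decidable-stable (_ ≟ᵇ _) λ v → none (a , b , v))
      in nonconjunctive-op⇒ meet∈C {f} f∈C a b violated

generators : ExcludedMiddle ℓ → {C : Class ℓ} → IsClone C → ¬ (C ⊑ Λ ⊎ C ⊑ V ⊎ C ⊑ L) →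
             ternary majority ∈ C ⊎ ternary meetJoin ∈ C ⊎ ternary meetJoin ∈ Dual C
generators em {C} isClone C⋢ = cases (⋢L⇒ em isClone (C⋢ ∘ inj₂ ∘ inj₂))
  where
  open IsClone isClone
  meet∈Dual : ternary join ∈ C → ternary meet ∈ Dual C
  meet∈Dual join∈C = resp-≗ {f = ternary join} {dual (ternary meet)} join≗ join∈C
    where
    join≗ : ternary join ≗ dual (ternary meet)
    join≗ (true  ∷ y     ∷ z ∷ []) = refl
    join≗ (false ∷ true  ∷ z ∷ []) = refl
    join≗ (false ∷ false ∷ z ∷ []) = refl
  dualize : Dual C ⊑ Λ → C ⊑ V
  dualize Dual⊑Λ f f∈C = dual-Λ⇒V {f = f} (Dual⊑Λ (dual f) (resp-≗ (sym ∘ dual-involutive f) f∈C))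
  cases : ternary meet ∈ C ⊎ ternary join ∈ C ⊎ ternary majority ∈ C →
          ternary majority ∈ C ⊎ ternary meetJoin ∈ C ⊎ ternary meetJoin ∈ Dual C
  cases (inj₁ meet∈C)        = inj₂ (inj₁ (⋢Λ⇒ em isClone meet∈C (C⋢ ∘ inj₁)))
  cases (inj₂ (inj₁ join∈C)) = inj₂ (inj₂ (⋢Λ⇒ em {Dual C} (dual-isClone isClone) (meet∈Dual join∈C)
    λ Dual⊑Λ → C⋢ (inj₂ (inj₁ (dualize Dual⊑Λ)))))
  cases (inj₂ (inj₂ maj∈C))  = inj₁ maj∈C

-- Members of the clones of majority and x ∧ (y ∨ z)

_⊆_ : Vec Bool n → Vec Bool n → Set
a ⊆ b = ∀ i → lookup a i ≡ true → lookup b i ≡ true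

Monotone : Op n → Set
Monotone f = ∀ a b → a ⊆ b → f a ≡ true → f b ≡ true

allTuples : ∀ n → Σ[ k ∈ ℕ ] Σ[ as ∈ Vec (Vec Bool n) k ] (∀ a → a Vec.∈ as)
allTuples zero    = 1 , [] ∷ [] , λ { [] → here refl }
allTuples (suc n) =
  let k , as , complete = allTuples n
  in k ℕ.+ k , map (true ∷_) as ++ map (false ∷_) as , λ
     { (true  ∷ a) → ∈-++⁺ˡ (∈-map⁺ (true ∷_) (complete a))
     ; (false ∷ a) → ∈-++⁺ʳ (map (true ∷_) as) (∈-map⁺ (false ∷_) (complete a)) }

module Interpolation {ℓ} {C : Class ℓ} (isClone : IsClone C) where
  open IsClone isClone
  open Generation isClone

  -- A monotone selfdual function agrees with a projection on any two tuples;
  -- the majority operation extends this to any finite set of tuples.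
  module _ (majority∈C : ternary majority ∈ C) {f : Op (suc n)} (mono : Monotone f) (selfdual : dual f ≗ f) where

    private
      orient : Bool → Vec Bool (suc n) → Vec Bool (suc n)
      orient true  a = a
      orient false a = map not a

      f-map-not : ∀ a → f (map not a) ≡ not (f a)
      f-map-not a = trans (sym (not-involutive _)) (cong not (selfdual a))

      f-orient : ∀ a x → f a ≡ x → f (orient x a) ≡ true
      f-orient a true  eq = eq
      f-orient a false eq = trans (f-map-not a) (cong not eq)

      lookup-orient : ∀ x a i → lookup (orient x a) i ≡ true → lookup a i ≡ x
      lookup-orient true  a i eq = eq
      lookup-orient false a i eq = trans (sym (not-involutive _)) (cong not (trans (sym (lookup-map i not a)) eq))

    -- Complementing if necessary, let `f` be true at both tuples. If they had no common true entry,
    -- the first would lie below the complement of the second, where a selfdual `f` is false,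
    -- against monotonicity.
    common-projection : ∀ a b → ∃[ i ] (lookup a i ≡ f a × lookup b i ≡ f b)
    common-projection a b = decidable-stable
      (any? λ i → (lookup a i ≟ᵇ f a) ×-dec (lookup b i ≟ᵇ f b)) λ none →
      contradiction
        (trans (sym (mono a′ (map not b′) (disjoint none) (f-orient a (f a) refl)))
               (trans (f-map-not b′) (cong not (f-orient b (f b) refl)))) λ ()
      where
      a′ = orient (f a) a
      b′ = orient (f b) b
      disjoint : ¬ (∃[ i ] (lookup a i ≡ f a × lookup b i ≡ f b)) → a′ ⊆ map not b′
      disjoint none i a′ᵢ with lookup b′ i in eq
      ... | false = trans (lookup-map i not b′) (cong not eq)
      ... | true  = contradiction (i , lookup-orient (f a) a i a′ᵢ , lookup-orient (f b) b i eq) none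

    -- The Baker-Pixley induction. Three interpolants each omit one of the first three tuples, so at
    -- every tuple at least two of them are correct and win the vote.
    majority-interpolate : (as : Vec (Vec Bool (suc n)) k) →
                           Σ[ t ∈ Op (suc n) ] (t ∈ C × All (λ a → t a ≡ f a) as)
    majority-interpolate [] = _ , projection zero , []
    majority-interpolate (a ∷ []) =
      let i , aᵢ , _ = common-projection a a in _ , projection i , aᵢ ∷ []
    majority-interpolate (a ∷ b ∷ []) =
      let i , aᵢ , bᵢ = common-projection a b in _ , projection i , aᵢ ∷ bᵢ ∷ []
    majority-interpolate (a ∷ b ∷ c ∷ as)
      with majority-interpolate (b ∷ c ∷ as) | majority-interpolate (a ∷ c ∷ as) | majority-interpolate (a ∷ b ∷ as)
    ... | t₁ , t₁∈C , b₁ ∷ c₁ ∷ as₁ | t₂ , t₂∈C , a₂ ∷ c₂ ∷ as₂ | t₃ , t₃∈C , a₃ ∷ b₃ ∷ as₃ =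
      _ , ternary-closed majority∈C t₁∈C t₂∈C t₃∈C ,
      two₂₃ a₂ a₃ ∷ two₁₃ b₁ b₃ ∷ two₁₂ c₁ c₂ ∷ All.map (λ (p , q) → two₁₂ p q) (All.zip (as₁ , as₂))
      where
      two₁₂ : ∀ {x y z w} → x ≡ w → y ≡ w → majority x y z ≡ w
      two₁₂ {true}  refl refl = refl
      two₁₂ {false} refl refl = refl
      two₁₃ : ∀ {x y z w} → x ≡ w → z ≡ w → majority x y z ≡ w
      two₁₃ {true}  {y} refl refl = ∨-zeroʳ y
      two₁₃ {false} {true} refl refl = refl
      two₁₃ {false} {false} refl refl = refl
      two₂₃ : ∀ {x y z w} → y ≡ w → z ≡ w → majority x y z ≡ w
      two₂₃ {true}  {true}  refl refl = refl
      two₂₃ {true}  {false} refl refl = refl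
      two₂₃ {false} {true}  refl refl = refl
      two₂₃ {false} {false} refl refl = refl

    monotone-selfdual-∈ : f ∈ C
    monotone-selfdual-∈ =
      let _ , as , complete = allTuples (suc n)
          t , t∈C , agree   = majority-interpolate as
      in resp-≗ (λ a → All.lookup agree (complete a)) t∈C

  module _ (meetJoin∈C : ternary meetJoin ∈ C) where

    -- Meets are available as x ∧ (y ∨ y). The conjunction starts from argument `zero`, which is
    -- true in `a`, and collects those listed arguments that are true in `a`.
    meet-below : (a : Vec Bool (suc n)) → lookup a zero ≡ true → (is : Vec (Fin (suc n)) k) →
                 Σ[ t ∈ Op (suc n) ] (t ∈ C × t a ≡ true × (∀ b → t b ≡ true → All (λ i → lookup a i ≡ true → lookup b i ≡ true) is))
    meet-below a a₀ [] = _ , projection zero , a₀ , λ _ _ → []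
    meet-below a a₀ (i ∷ is) with meet-below a a₀ is | lookup a i in eq
    ... | t , t∈C , ta , below | false = t , t∈C , ta , λ b tb → (λ aᵢ → contradiction (trans (sym eq) aᵢ) λ ()) ∷ below b tb
    ... | t , t∈C , ta , below | true  =
      _ , ternary-closed meetJoin∈C t∈C (projection i) (projection i) , at-a , λ b e → (λ _ → second (t b) (lookup b i) e) ∷ below b (first (t b) (lookup b i) e)
      where
      at-a : t a ∧ (lookup a i ∨ lookup a i) ≡ true
      at-a rewrite ta | eq = refl
      first : ∀ x y → x ∧ (y ∨ y) ≡ true → x ≡ true
      first true y e = refl
      second : ∀ x y → x ∧ (y ∨ y) ≡ true → y ≡ true
      second true true e = refl

    minimal-meet : (a : Vec Bool (suc n)) → lookup a zero ≡ true →
                   Σ[ t ∈ Op (suc n) ] (t ∈ C × t a ≡ true × (∀ b → t b ≡ true → a ⊆ b))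
    minimal-meet a a₀ =
      let t , t∈C , ta , below = meet-below a a₀ (allFin _)
      in t , t∈C , ta , λ b tb i → All.lookup (below b tb) (∈-allFin⁺ i)

    module _ {f : Op (suc n)} (mono : Monotone f) (f𝟏 : f 𝟏 ≡ true) (guard : ∀ a → f a ≡ true → lookup a zero ≡ true) where

      -- A disjunctive normal form built under the guard: joins are only available as x ∧ (y ∨ z),
      -- with argument `zero` as x. In place of the empty join, the start is the meet of all
      -- arguments, which is below `f` because of `f𝟏`.
      guarded-interpolate : (as : Vec (Vec Bool (suc n)) k) →
        Σ[ t ∈ Op (suc n) ] (t ∈ C × (∀ b → t b ≡ true → f b ≡ true) × All (λ a → f a ≡ true → t a ≡ true) as)
      guarded-interpolate [] =
        let t , t∈C , _ , above = minimal-meet 𝟏 (lookup-replicate {n = suc n} zero true)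
        in t , t∈C , (λ b tb → mono 𝟏 b (above b tb) f𝟏) , []
      guarded-interpolate (a ∷ as) with guarded-interpolate as | f a in fa
      ... | t , t∈C , below , hits | false = t , t∈C , below , (λ e → contradiction (trans (sym fa) e) λ ()) ∷ hits
      ... | t , t∈C , below , hits | true  =
        let s , s∈C , sa , above = minimal-meet a (guard a fa)
        in _ , ternary-closed meetJoin∈C (projection zero) s∈C t∈C
         , (λ b e → either (lookup b zero) (s b) e (λ sb → mono a b (above b sb) fa) (below b))
         , (λ e → cong₂ _∧_ (guard a e) (cong (_∨ t a) sa))
         ∷ All.map (λ {c} hit e → cong₂ _∧_ (guard c e) (trans (cong (s c ∨_) (hit e)) (∨-zeroʳ (s c)))) hits
        where
        either : ∀ x y {z} {A : Set} → x ∧ (y ∨ z) ≡ true → (y ≡ true → A) → (z ≡ true → A) → A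
        either true true  e l r = l refl
        either true false e l r = r e

      monotone-guarded-∈ : f ∈ C
      monotone-guarded-∈ =
        let _ , as , complete = allTuples (suc n)
            t , t∈C , below , hits = guarded-interpolate as
        in resp-≗ (λ a → iff (below a) (All.lookup hits (complete a))) t∈C
        where
        iff : ∀ {x y} → (x ≡ true → y ≡ true) → (y ≡ true → x ≡ true) → x ≡ y
        iff {true}          p q = sym (p refl)
        iff {false} {true}  p q = q refl
        iff {false} {false} p q = refl

-- Functions of blocks of two points

does⇒ : {P : Set} (P? : Dec P) → does P? ≡ true → P
does⇒ (yes p) _ = p

truth-ext : {x y : Bool} → (x ≡ true → y ≡ true) → (y ≡ true → x ≡ true) → x ≡ y
truth-ext {true}          p q = sym (p refl)
truth-ext {false} {true}  p q = q refl
truth-ext {false} {false} p q = refl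

parity : (Fin k → Bool) → Bool
parity {zero}  h = false
parity {suc k} h = h zero xor parity (h ∘ suc)

odd : ℕ → Bool
odd zero    = false
odd (suc k) = not (odd k)

parity-cong : {h h′ : Fin k → Bool} → h ≗ h′ → parity h ≡ parity h′
parity-cong {zero}  e = refl
parity-cong {suc k} e = cong₂ _xor_ (e zero) (parity-cong (e ∘ suc))

parity-change : {h h′ : Fin k → Bool} (c : Fin k) → h c ≡ not (h′ c) → (∀ b → b ≢ c → h b ≡ h′ b) → parity h ≡ not (parity h′)
parity-change {suc k} {h} {h′} zero    at off =
  trans (cong₂ _xor_ at (parity-cong (λ b → off (suc b) λ ()))) (sym (not-distribˡ-xor (h′ zero) _))
parity-change {suc k} {h} {h′} (suc c) at off =
  trans (cong₂ _xor_ (off zero λ ()) (parity-change c at λ b b≢c → off (suc b) λ { refl → b≢c refl }))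
        (sym (not-distribʳ-xor (h′ zero) _))

parity-not : (h : Fin k → Bool) → parity (not ∘ h) ≡ odd k xor parity h
parity-not {zero}  h = refl
parity-not {suc k} h = trans (cong (not (h zero) xor_) (parity-not (h ∘ suc))) (shuffle (h zero) (odd k) _)
  where
  shuffle : ∀ x y z → not x xor (y xor z) ≡ not y xor (x xor z)
  shuffle true  true  z = refl
  shuffle true  false z = sym (not-involutive z)
  shuffle false true  z = not-involutive z
  shuffle false false z = refl

parity-false : ∀ k → parity {k} (λ _ → false) ≡ false
parity-false zero    = refl
parity-false (suc k) = parity-false k

module Blocks {m : ℕ} (s : Fin m → Fin m) (s³ : ∀ b → s (s (s b)) ≡ b) (s≢ : ∀ b → s b ≢ b)
              (6≤m : 6 ≤ m) (m-odd : odd m ≡ true) where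

  s²≢ : ∀ b → s (s b) ≢ b
  s²≢ b eq = s≢ b (sym (trans (sym (s³ b)) (cong s eq)))

  -- The block b consists of the points (b , true) and (b , false).
  Point : Set
  Point = Fin m × Bool

  Config : Set
  Config = Point → Bool

  complement : Config → Config
  complement a = not ∘ a

  Full Occupied : Config → Fin m → Set
  Full     a b = ∀ t → a (b , t) ≡ true
  Occupied a b = ∃[ t ] (a (b , t) ≡ true)

  -- Nothing is asked of the block `s c`. If it is occupied, then all blocks are, and `s (s c)` is
  -- full, so the configuration is on for both parities anyway. The notion has effect only when
  -- `s c` is empty.
  Exceptional : Config → Fin m → Set
  Exceptional a c = a (c , true) ≡ true × (∀ b → b ≢ c → b ≢ s c → Full a b)

  -- When every block contains exactly one chosen point, the value depends on
  -- the parity of the number of chosen points (b , false).  The exceptional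
  -- configurations break the symmetry between the two points of a block.
  On : Bool → Config → Set
  On β a = ∃ (Exceptional a) ⊎
           (∀ b → Occupied a b) × (∃ (Full a) ⊎ parity (λ b → a (b , false)) ≡ β)

  full? : ∀ a b → Dec (Full a b)
  full? a b = map′ (λ { (p , q) true → p ; (p , q) false → q }) (λ h → h true , h false)
                   ((a (b , true) ≟ᵇ true) ×-dec (a (b , false) ≟ᵇ true))

  occupied? : ∀ a b → Dec (Occupied a b)
  occupied? a b = map′ (λ { (inj₁ p) → true , p ; (inj₂ p) → false , p }) (λ { (true , p) → inj₁ p ; (false , p) → inj₂ p })
                       ((a (b , true) ≟ᵇ true) ⊎-dec (a (b , false) ≟ᵇ true))

  on? : ∀ β a → Dec (On β a)
  on? β a =
    any? (λ c → (a (c , true) ≟ᵇ true) ×-dec allFin? (λ b → ¬? (b ≟ c) →-dec ¬? (b ≟ s c) →-dec full? a b)) ⊎-dec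
    (allFin? (occupied? a) ×-dec (any? (full? a) ⊎-dec (parity (λ b → a (b , false)) ≟ᵇ β)))

  abstract
    F : Bool → Config → Bool
    F β a = does (on? β a)

    F-on : ∀ {β a} → F β a ≡ true → On β a
    F-on {β} {a} = does⇒ (on? β a)

    on-F : ∀ {β a} → On β a → F β a ≡ true
    on-F {β} {a} = dec-true (on? β a)

    off-F : ∀ {β a} → ¬ On β a → F β a ≡ false
    off-F {β} {a} = dec-false (on? β a)

  _≤ᶜ_ : Config → Config → Set
  a ≤ᶜ a′ = ∀ q → a q ≡ true → a′ q ≡ true

  -- Only the parity clause could be lost. But adding a point to a choice of one point per block
  -- makes some block full, and then parity no longer counts.
  on-mono : ∀ {β a a′} → a ≤ᶜ a′ → On β a → On β a′
  on-mono a≤a′ (inj₁ (c , c⁺ , full)) = inj₁ (c , a≤a′ _ c⁺ , λ b b≢c b≢sc t → a≤a′ _ (full b b≢c b≢sc t))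
  on-mono a≤a′ (inj₂ (occ , inj₁ (b , full))) =
    inj₂ ((λ b → proj₁ (occ b) , a≤a′ _ (proj₂ (occ b))) , inj₁ (b , λ t → a≤a′ _ (full t)))
  on-mono {β} {a} {a′} a≤a′ (inj₂ (occ , inj₂ par)) with any? (full? a′)
  ... | yes full = inj₂ ((λ b → proj₁ (occ b) , a≤a′ _ (proj₂ (occ b))) , inj₁ full)
  ... | no ¬full = inj₂ ((λ b → proj₁ (occ b) , a≤a′ _ (proj₂ (occ b))) , inj₂ (trans (parity-cong same) par))
    where
    same : ∀ b → a′ (b , false) ≡ a (b , false)
    same b = truth-ext lower (a≤a′ _)
      where
      lower : a′ (b , false) ≡ true → a (b , false) ≡ true
      lower a′⁻ with occ b
      ... | false , a⁻ = a⁻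
      ... | true  , a⁺ = contradiction (b , λ { true → a≤a′ _ a⁺ ; false → a′⁻ }) ¬full

  F-mono : ∀ {β a a′} → a ≤ᶜ a′ → F β a ≡ true → F β a′ ≡ true
  F-mono a≤a′ = on-F ∘ on-mono a≤a′ ∘ F-on

  F-cong : ∀ {β a a′} → a ≗ a′ → F β a ≡ F β a′
  F-cong a≗a′ = truth-ext (F-mono λ q e → trans (sym (a≗a′ q)) e) (F-mono λ q e → trans (a≗a′ q) e)

  τ : Fin m → Point → Point
  τ c (b , t) = b , (if does (b ≟ c) then not t else t)

  τ-at : ∀ c t → τ c (c , t) ≡ (c , not t)
  τ-at c t rewrite dec-true (c ≟ c) refl = refl

  τ-off : ∀ c {b} → b ≢ c → ∀ t → τ c (b , t) ≡ (b , t)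
  τ-off c {b} b≢c t rewrite dec-false (b ≟ c) b≢c = refl

  τ-involutive : ∀ c q → τ c (τ c q) ≡ q
  τ-involutive c (b , t) with b ≟ c
  ... | yes _ = cong (b ,_) (not-involutive t)
  ... | no _  = refl

  full-τ : ∀ {a} c {b} → Full a b → Full (a ∘ τ c) b
  full-τ c full t = full _

  occupied-τ : ∀ {a} c {b} → Occupied a b → Occupied (a ∘ τ c) b
  occupied-τ {a} c {b} (t , e) = proj₂ (τ c (b , t)) , trans (cong a (τ-involutive c (b , t))) e

  -- Under this condition, a and its flip at c are not told apart by
  -- exceptional configurations.
  Mild : Fin m → Config → Set
  Mild c a = (∀ b → b ≢ c → b ≢ s c → Full a b) → Occupied a (s c)

  -- An exceptional configuration at a block other than `c` stays exceptional. One at `c` has `s c`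
  -- occupied by mildness, hence all blocks occupied and `s (s c)` full. For a choice of one point
  -- per block, the flip changes the parity.
  on-flip : ∀ {β a} c → Mild c a → On β a → On (not β) (a ∘ τ c)
  on-flip {a = a} c mild (inj₁ (d , d⁺ , full)) with d ≟ c
  ... | no d≢c = inj₁ (d , trans (cong a (τ-off c d≢c true)) d⁺ , λ b b≢d b≢sd → full-τ {a} c (full b b≢d b≢sd))
  ... | yes refl = inj₂ ((λ b → occ b (b ≟ c) (b ≟ s c)) , inj₁ (s (s c) , full-τ {a} c (full (s (s c)) (s²≢ c) (s≢ (s c)))))
    where
    occ : ∀ b → Dec (b ≡ c) → Dec (b ≡ s c) → Occupied (a ∘ τ c) b
    occ b (yes refl) _          = occupied-τ {a} c (true , d⁺)
    occ b (no _)     (yes refl) = occupied-τ {a} c (mild full)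
    occ b (no b≢c)   (no b≢sc)  = true , full-τ {a} c (full b b≢c b≢sc) true
  on-flip {a = a} c mild (inj₂ (occ , inj₁ (b , full))) = inj₂ (occupied-τ {a} c ∘ occ , inj₁ (b , full-τ {a} c full))
  on-flip {a = a} c mild (inj₂ (occ , inj₂ par)) with any? (full? a)
  ... | yes (b , full) = inj₂ (occupied-τ {a} c ∘ occ , inj₁ (b , full-τ {a} c full))
  ... | no ¬full = inj₂ (occupied-τ {a} c ∘ occ , inj₂ (trans (parity-change c at λ b b≢c → cong a (τ-off c b≢c false)) (cong not par)))
    where
    differ : a (c , true) ≡ not (a (c , false))
    differ with a (c , true) in e⁺ | a (c , false) in e⁻ | occ c
    ... | true  | false | _ = refl
    ... | false | true  | _ = refl
    ... | true  | true  | _ = contradiction (c , λ { true → e⁺ ; false → e⁻ }) ¬full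
    ... | false | false | true  , e = trans (sym e⁺) e
    ... | false | false | false , e = trans (sym e⁻) e
    at : a (τ c (c , false)) ≡ not (a (c , false))
    at = trans (cong a (τ-at c false)) differ

  mild-τ : ∀ {a} c → Mild c a → Mild c (a ∘ τ c)
  mild-τ {a} c mild full = occupied-τ {a} c (mild λ b b≢c b≢sc t → trans (sym (cong a (τ-off c b≢c t))) (full b b≢c b≢sc t))

  F-flip : ∀ {β a} c → Mild c a → F β a ≡ F (not β) (a ∘ τ c)
  F-flip {β} {a} c mild = truth-ext (on-F ∘ on-flip c mild ∘ F-on)
    λ e → on-F (on-mono (λ q eq → trans (sym (cong a (τ-involutive c q))) eq)
      (subst (λ γ → On γ (a ∘ τ c ∘ τ c)) (not-involutive β) (on-flip c (mild-τ {a} c mild) (F-on e))))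

  -- If the block `p` is occupied at all, it is full, and parity plays no part. Two points of the
  -- same block can therefore be merged with no permutation at all.
  F-merged-block : ∀ {β a} p → a (p , true) ≡ a (p , false) → F β a ≡ F (not β) a
  F-merged-block {β} {a} p eq = truth-ext (on-F ∘ swap ∘ F-on) (on-F ∘ swap ∘ F-on)
    where
    swap : ∀ {β γ} → On β a → On γ a
    swap (inj₁ exc) = inj₁ exc
    swap (inj₂ (occ , _)) = inj₂ (occ , inj₁ (p , full (occ p)))
      where
      full : Occupied a p → Full a p
      full (true  , e) true  = e
      full (true  , e) false = trans (sym eq) e
      full (false , e) true  = trans eq e
      full (false , e) false = e

  block-outside₄ : (c d e f : Fin m) → ∃[ b ] (b ≢ c × b ≢ d × b ≢ e × b ≢ f)
  block-outside₄ c d e f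
    with missed-value (≤-trans (n≤1+n 5) 6≤m) (λ { #0 → c ; #1 → d ; #2 → e ; #3 → f })
  ... | b , b∉ = b , ≢-sym (b∉ #0) , ≢-sym (b∉ #1) , ≢-sym (b∉ #2) , ≢-sym (b∉ #3)

  -- Two exceptional configurations share a full block, as at most four blocks are excluded. A full
  -- block of one configuration meets any other with all blocks occupied. For two complementary
  -- choices of one point per block, the parities differ since `m` is odd.
  intersecting : ∀ {β a} → F β a ≡ true → F β (complement a) ≡ true → ∀ {A : Set} → A
  intersecting {β} {a} e e′ = clash (F-on e) (F-on e′)
    where
    disjoint : ∀ {a′ : Config} {b} → Full a′ b → ¬ Occupied (complement a′) b
    disjoint full (t , e) = contradiction (trans (sym (cong not (full t))) e) λ ()
    disjoint′ : ∀ {a′ : Config} {b} → Full (complement a′) b → ¬ Occupied a′ b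
    disjoint′ full (t , e) = contradiction (trans (sym (cong not e)) (full t)) λ ()
    clash : On β a → On β (complement a) → ∀ {A : Set} → A
    clash (inj₁ (c , _ , full)) (inj₁ (d , _ , full′)) =
      let b , b≢c , b≢sc , b≢d , b≢sd = block-outside₄ c (s c) d (s d)
      in contradiction (true , full′ b b≢d b≢sd true) (disjoint {a} (full b b≢c b≢sc))
    clash (inj₁ (c , _ , full)) (inj₂ (occ , _)) =
      contradiction (occ _) (disjoint {a} (full (s (s c)) (s²≢ c) (s≢ (s c))))
    clash (inj₂ (occ , _)) (inj₁ (c , _ , full)) =
      contradiction (occ _) (disjoint′ {a} (full (s (s c)) (s²≢ c) (s≢ (s c))))
    clash (inj₂ (occ , inj₁ (b , full))) (inj₂ (occ′ , _)) = contradiction (occ′ b) (disjoint {a} full)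
    clash (inj₂ (occ , _)) (inj₂ (_ , inj₁ (b , full))) = contradiction (occ b) (disjoint′ {a} full)
    clash (inj₂ (_ , inj₂ par)) (inj₂ (_ , inj₂ par′)) =
      contradiction negated (not-¬ (trans par′ (sym par)))
      where
      negated : parity (λ b → not (a (b , false))) ≡ not (parity (λ b → a (b , false)))
      negated = trans (parity-not (λ b → a (b , false))) (cong (_xor parity (λ b → a (b , false))) m-odd)

  open import Data.List.Membership.DecPropositional (≡-dec {A = Fin m} {B = λ _ → Bool} _≟_ _≟ᵇ_) using (_∈?_) public

  abstract
    without : List Point → Config
    without S q = not (does (q ∈? S))

    without-∈ : ∀ {S q} → q ∈ᴸ S → without S q ≡ false
    without-∈ {S} {q} q∈S = cong not (dec-true (q ∈? S) q∈S)

    without-∉ : ∀ {S q} → q ∉ᴸ S → without S q ≡ true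
    without-∉ {S} {q} q∉S = cong not (dec-false (q ∈? S) q∉S)

  without-true : ∀ {S q} → without S q ≡ true → q ∉ᴸ S
  without-true e q∈S = contradiction (trans (sym e) (without-∈ q∈S)) λ ()

  partner : Point → Point
  partner (b , t) = b , not t

  partner≢ : ∀ {q} → partner q ≢ q
  partner≢ {b , true} ()
  partner≢ {b , false} ()

  -- Every block keeps a point, and a block containing none of `x`, `y`, `z` is full.
  partner-free-on : ∀ {β x y z} → (∀ q → q ∈ᴸ x ∷ y ∷ z ∷ [] → partner q ∉ᴸ x ∷ y ∷ z ∷ []) → F β (without (x ∷ y ∷ z ∷ [])) ≡ true
  partner-free-on {β} {x} {y} {z} free = on-F (inj₂ (occ , inj₁ (b , λ t → without-∉ λ
      { (here eq)                 → b≢x (cong proj₁ eq)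
      ; (there (here eq))         → b≢y (cong proj₁ eq)
      ; (there (there (here eq))) → b≢z (cong proj₁ eq) })))
    where
    S = x ∷ y ∷ z ∷ []
    occ : ∀ b → Occupied (without S) b
    occ b with (b , true) ∈? S
    ... | no ∉S  = true , without-∉ ∉S
    ... | yes ∈S = false , without-∉ (free (b , true) ∈S)
    outside = avoid₃ (≤-trans (m≤m+n 4 2) 6≤m) (proj₁ x) (proj₁ y) (proj₁ z)
    b = proj₁ outside
    b≢x = proj₁ (proj₂ outside)
    b≢y = proj₁ (proj₂ (proj₂ outside))
    b≢z = proj₂ (proj₂ (proj₂ outside))

  -- With `e` empty, the configuration can only be exceptional at the block whose successor is `e`,
  -- namely `s (s e)`. One more zero outside `e` excludes this, unless it is the `false` point of
  -- `s (s e)`.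
  empty-block-off : ∀ {β a e z t} → (∀ t → a (e , t) ≡ false) → z ≢ e → a (z , t) ≡ false →
                    (z ≢ s (s e) ⊎ t ≡ true) → F β a ≡ false
  empty-block-off {β} {a} {e} {z} {t} empty z≢e zero-z ordinary = off-F λ
    { (inj₁ (c , c⁺ , full)) → exceptional c c⁺ full
    ; (inj₂ (occ , _))       → contradiction (trans (sym (proj₂ (occ e))) (empty _)) λ () }
    where
    exceptional : ∀ c → a (c , true) ≡ true → ¬ (∀ b → b ≢ c → b ≢ s c → Full a b)
    exceptional c c⁺ full = cases (e ≟ c) (e ≟ s c) (z ≟ c) ordinary
      where
      cases : Dec (e ≡ c) → Dec (e ≡ s c) → Dec (z ≡ c) → ¬ (z ≢ s (s e) ⊎ t ≡ true)
      cases (yes refl) _ _ _ = contradiction (trans (sym c⁺) (empty true)) λ ()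
      cases (no e≢c) (no e≢sc) _ _ = contradiction (trans (sym (full e e≢c e≢sc true)) (empty true)) λ ()
      cases (no _) (yes refl) (no z≢c) _ = contradiction (trans (sym (full z z≢c z≢e t)) zero-z) λ ()
      cases (no _) (yes refl) (yes refl) (inj₁ z≢s²e) = z≢s²e (sym (s³ c))
      cases (no _) (yes refl) (yes refl) (inj₂ refl)  = contradiction (trans (sym c⁺) zero-z) λ ()

  two-empty-blocks-off : ∀ {β a b c} → b ≢ c → (∀ t → a (b , t) ≡ false) → (∀ t → a (c , t) ≡ false) → F β a ≡ false
  two-empty-blocks-off {a = a} b≢c empty-b empty-c = empty-block-off {a = a} {t = true} empty-b (≢-sym b≢c) (empty-c true) (inj₂ refl)

  -- Rigidity

  module _ (σ ρ : Point → Point) (σρ : ∀ q → σ (ρ q) ≡ q) (ρσ : ∀ q → ρ (σ q) ≡ q)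
           (transfer : ∀ a → F true a ≡ F false (a ∘ σ)) where

    private
      ρ-injective : ∀ {q r} → ρ q ≡ ρ r → q ≡ r
      ρ-injective {q} {r} eq = trans (sym (σρ q)) (trans (cong σ eq) (σρ r))

      -- The zero set of `without S ∘ σ` is the image of `S` under `ρ`.
      on-image : ∀ {S} → F false (without (mapᴸ ρ S)) ≡ true → F true (without S) ≡ true
      on-image {S} e = trans (transfer (without S)) (F-mono below e)
        where
        below : without (mapᴸ ρ S) ≤ᶜ (without S ∘ σ)
        below q e = without-∉ λ σq∈S → without-true {mapᴸ ρ S} e (subst (_∈ᴸ mapᴸ ρ S) (ρσ q) (∈ᴸ-map⁺ ρ σq∈S))

      zero-image : ∀ {S q} → q ∈ᴸ S → without S (σ (ρ q)) ≡ false
      zero-image {S} {q} q∈S = trans (cong (without S) (σρ q)) (without-∈ q∈S)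

      partner-of : ∀ {q r : Point} → proj₁ q ≡ proj₁ r → q ≢ r → q ≡ partner r
      partner-of {b , t} {.b , t′} refl q≢r = cong (b ,_) (¬-not (λ { refl → q≢r refl }))

      partner-partner : ∀ q → partner (partner q) ≡ q
      partner-partner (b , t) = cong (b ,_) (not-involutive t)

      module _ (e : Fin m) (split : proj₁ (ρ (e , true)) ≢ proj₁ (ρ (e , false))) where

        y₁ = ρ (e , true)
        y₂ = ρ (e , false)

        -- The zero set formed by the block `e` and (z , t) turns `F true` off. Were its image free
        -- of partners, `F false` would be on there. The images `y₁` and `y₂` are no partners when
        -- `e` is split, so the third image is a partner of one of them.
        third-partner : ∀ {z t} → z ≢ e → (z ≢ s (s e) ⊎ t ≡ true) → ρ (z , t) ≡ partner y₁ ⊎ ρ (z , t) ≡ partner y₂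
        third-partner {z} {t} z≢e ordinary = decidable-stable (≡-dec _≟_ _≟ᵇ_ _ _ ⊎-dec ≡-dec _≟_ _≟ᵇ_ _ _) λ neither →
          contradiction (trans (sym (on-image {S} (partner-free-on (free (neither ∘ inj₁) (neither ∘ inj₂)))))
            (empty-block-off {a = without S} {t = t} (λ { true → without-∈ {S} (here refl) ; false → without-∈ {S} (there (here refl)) })
              z≢e (without-∈ {S} (there (there (here refl)))) ordinary)) λ ()
          where
          S = (e , true) ∷ (e , false) ∷ (z , t) ∷ []
          w = ρ (z , t)
          flipped : ∀ {q r} → partner q ≡ r → q ≡ partner r
          flipped {q} eq = trans (sym (partner-partner q)) (cong partner eq)
          free : w ≢ partner y₁ → w ≢ partner y₂ → ∀ q → q ∈ᴸ y₁ ∷ y₂ ∷ w ∷ [] → partner q ∉ᴸ y₁ ∷ y₂ ∷ w ∷ []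
          free w≢ȳ₁ w≢ȳ₂ q (here refl)                 (here eq)                 = partner≢ eq
          free w≢ȳ₁ w≢ȳ₂ q (here refl)                 (there (here eq))         = split (cong proj₁ eq)
          free w≢ȳ₁ w≢ȳ₂ q (here refl)                 (there (there (here eq))) = w≢ȳ₁ (sym eq)
          free w≢ȳ₁ w≢ȳ₂ q (there (here refl))         (here eq)                 = split (sym (cong proj₁ eq))
          free w≢ȳ₁ w≢ȳ₂ q (there (here refl))         (there (here eq))         = partner≢ eq
          free w≢ȳ₁ w≢ȳ₂ q (there (here refl))         (there (there (here eq))) = w≢ȳ₂ (sym eq)
          free w≢ȳ₁ w≢ȳ₂ q (there (there (here refl))) (here eq)                 = w≢ȳ₁ (flipped eq)
          free w≢ȳ₁ w≢ȳ₂ q (there (there (here refl))) (there (here eq))         = w≢ȳ₂ (flipped eq)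
          free w≢ȳ₁ w≢ȳ₂ q (there (there (here refl))) (there (there (here eq))) = partner≢ eq

        -- Three distinct points would have their images among two.
        unsplit : ∀ {A : Set} → A
        unsplit with third-partner {s e} {true} (s≢ e) (inj₂ refl)
                   | third-partner {s e} {false} (s≢ e) (inj₁ (≢-sym (s≢ (s e))))
                   | third-partner {s (s e)} {true} (s²≢ e) (inj₂ refl)
        ... | inj₁ p | inj₁ q | _      = contradiction (ρ-injective (trans p (sym q))) λ ()
        ... | inj₂ p | inj₂ q | _      = contradiction (ρ-injective (trans p (sym q))) λ ()
        ... | inj₁ p | inj₂ q | inj₁ r = contradiction (cong proj₁ (ρ-injective (trans r (sym p)))) (s≢ (s e))
        ... | inj₁ p | inj₂ q | inj₂ r = contradiction (cong proj₁ (ρ-injective (trans r (sym q)))) (s≢ (s e))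
        ... | inj₂ p | inj₁ q | inj₁ r = contradiction (cong proj₁ (ρ-injective (trans r (sym q)))) (s≢ (s e))
        ... | inj₂ p | inj₁ q | inj₂ r = contradiction (cong proj₁ (ρ-injective (trans r (sym p)))) (s≢ (s e))

      same-block : ∀ e → proj₁ (ρ (e , true)) ≡ proj₁ (ρ (e , false))
      same-block e = decidable-stable (_ ≟ _) λ split → unsplit e split

      image-block : ∀ e t → ∃[ t′ ] (ρ (e , t′) ≡ (proj₁ (ρ (e , true)) , t))
      image-block e t with proj₂ (ρ (e , true)) ≟ᵇ t
      ... | yes refl = true , refl
      ... | no neq   = false , trans (partner-of {ρ (e , false)} {ρ (e , true)} (sym (same-block e))
                         (λ eq → contradiction (ρ-injective eq) λ ())) (cong (_ ,_) (sym (¬-not (neq ∘ sym))))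

      -- A zero set consisting of the block s p and (p , t) is exceptional for
      -- t = false only, which tells the two points of the block p apart.
      sign-false : ∀ p → proj₂ (ρ (p , false)) ≡ false
      sign-false p with proj₂ (ρ (p , false)) in sign
      ... | false = refl
      ... | true  = contradiction (trans (sym on) (trans (transfer a) off)) λ ()
        where
        e = s p
        S = (e , true) ∷ (e , false) ∷ (p , false) ∷ []
        a = without S
        on : F true a ≡ true
        on = on-F (inj₁ (p , without-∉ {S} (λ { (here eq) → s≢ p (sym (cong proj₁ eq)) ; (there (here ())) ; (there (there (here ()))) ; (there (there (there ()))) })
                      , λ b b≢p b≢e t → without-∉ {S} λ { (here eq) → b≢e (cong proj₁ eq) ; (there (here eq)) → b≢e (cong proj₁ eq)
                                                         ; (there (there (here eq))) → b≢p (cong proj₁ eq) }))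
        empty : ∀ t → a (σ (proj₁ (ρ (e , true)) , t)) ≡ false
        empty t with image-block e t
        ... | true  , eq = trans (cong (a ∘ σ) (sym eq)) (zero-image {S} (here refl))
        ... | false , eq = trans (cong (a ∘ σ) (sym eq)) (zero-image {S} (there (here refl)))
        other : proj₁ (ρ (p , false)) ≢ proj₁ (ρ (e , true))
        other eq with image-block e (proj₂ (ρ (p , false)))
        ... | t , eq′ = s≢ p (cong proj₁ (ρ-injective (trans eq′ (cong (_, proj₂ (ρ (p , false))) (sym eq)))))
        off : F false (a ∘ σ) ≡ false
        off = empty-block-off {a = a ∘ σ} {t = proj₂ (ρ (p , false))} empty other (zero-image {S} (there (there (here refl)))) (inj₂ sign)

      sign-preserved : ∀ p t → proj₂ (ρ (p , t)) ≡ t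
      sign-preserved p false = sign-false p
      sign-preserved p true  = trans
        (cong proj₂ (partner-of {ρ (p , true)} {ρ (p , false)} (same-block p) λ eq → contradiction (ρ-injective eq) λ ()))
        (cong not (sign-false p))

    -- As signs are preserved, the choice of the `false` point in every block is invariant under
    -- `σ`. Its parity is that of `m`, so `F true` is on there and `F false` is off.
    rigid : ∀ {A : Set} → A
    rigid = contradiction (trans (sym on) (trans (transfer a) (trans (F-cong a∘σ≗a) off))) λ ()
      where
      a : Config
      a (_ , t) = not t
      a∘σ≗a : (a ∘ σ) ≗ a
      a∘σ≗a q = cong not (trans (sym (sign-preserved (proj₁ (σ q)) (proj₂ (σ q)))) (cong proj₂ (ρσ q)))
      all-true : parity {m} (λ _ → true) ≡ true
      all-true = trans (parity-not {m} (λ _ → false)) (trans (cong₂ _xor_ m-odd (parity-false m)) refl)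
      on : F true a ≡ true
      on = on-F (inj₂ ((λ b → false , refl) , inj₂ all-true))
      off : F false a ≡ false
      off = off-F λ { (inj₁ (c , () , _))
                    ; (inj₂ (_ , inj₁ (b , full))) → contradiction (full true) λ ()
                    ; (inj₂ (_ , inj₂ par)) → contradiction (trans (sym all-true) par) λ () }

-- The permutation may depend on the pair. Since it fixes both members, it keeps the tuples with
-- equal entries there among themselves and descends to the card; being an involution, it serves
-- both directions.
locally-permuted⇒stronglyHypomorphic : {f g : Op (suc n)} →
  (∀ {i j} → i ≢ j → Σ[ π ∈ (Fin (suc n) → Fin (suc n)) ] (π i ≡ i × π j ≡ j × (∀ k → π (π k) ≡ k) ×
     (∀ a → lookup a i ≡ lookup a j → f a ≡ g (a [ π ])))) →
  StronglyHypomorphic f g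
locally-permuted⇒stronglyHypomorphic {n} {f} {g} permuted I with permuted (lo≢hi I)
... | π , π-lo , π-hi , π² , f≗ = half f g f≗ , half g f λ a eq →
  trans (cong g (sym (trans ([]-∘ a π π) (trans ([]-cong a π²) ([]-id a))))) (sym (f≗ (a [ π ]) (permuted-eq a eq)))
  where
  permuted-eq : ∀ a → lookup a (lo I) ≡ lookup a (hi I) → lookup (a [ π ]) (lo I) ≡ lookup (a [ π ]) (hi I)
  permuted-eq a eq = trans (lookup-[] a π (lo I)) (trans (cong (lookup a) π-lo)
    (trans eq (sym (trans (lookup-[] a π (hi I)) (cong (lookup a) π-hi)))))
  half : (f g : Op (suc n)) → (∀ a → lookup a (lo I) ≡ lookup a (hi I) → f a ≡ g (a [ π ])) → identify f I ≼ identify g I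
  half f g f≗ = κ I ∘ π ∘ ι I , λ b →
    let a   = b [ κ I ]
        aeq = trans (lookup-[] b (κ I) (lo I)) (trans (cong (lookup b) (sym (κ-hi I))) (sym (lookup-[] b (κ I) (hi I))))
    in trans (identify-κ f I b) (trans (f≗ a aeq)
       (trans (cong g (sym (κ-ι-restore I (a [ π ]) (permuted-eq a aeq))))
       (trans (sym (identify-κ g I (a [ π ] [ ι I ])))
              (cong (identify g I) (trans (cong _[ ι I ] ([]-∘ b (κ I) π)) ([]-∘ b (κ I ∘ π) (ι I)))))))

-- An argument of `f` outside the range of `σ` would be inessential, so `σ` is onto and, by
-- counting, bijective.
essential-minor-bijective : {f g : Op n} → (∀ q → ¬ Inessential f q) → ((σ , _) : f ≼ g) →
  Σ[ ρ ∈ (Fin n → Fin n) ] ((∀ q → σ (ρ q) ≡ q) × (∀ p → ρ (σ p) ≡ p))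
essential-minor-bijective {f = f} {g} essential (σ , f≗) = ρ , σρ , ρσ
  where
  hit : ∀ q → ∃[ p ] (σ p ≡ q)
  hit q = decidable-stable (any? λ p → σ p ≟ q) λ missed → essential q λ a b off →
    trans (f≗ a) (trans (cong g (vec-ext λ k → trans (lookup-[] a σ k)
      (trans (off (σ k) (λ eq → missed (k , eq))) (sym (lookup-[] b σ k))))) (sym (f≗ b)))
  ρ = proj₁ ∘ hit
  σρ = proj₂ ∘ hit
  ρσ : ∀ p → ρ (σ p) ≡ p
  ρσ p with injective⇒surjective ≤-refl ρ (λ {q} {r} eq → trans (sym (σρ q)) (trans (cong σ eq) (σρ r))) p
  ... | q , refl = cong ρ (σρ q)

-- Boolean functions built from configurations

module Operations {m : ℕ} (s : Fin m → Fin m) (s³ : ∀ b → s (s (s b)) ≡ b) (s≢ : ∀ b → s b ≢ b)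
                  (6≤m : 6 ≤ m) (m-odd : odd m ≡ true) where

  open Blocks s s³ s≢ 6≤m m-odd

  some-block : Fin m
  some-block = proj₁ (missed-value {k = 0} (≤-trans (s≤s z≤n) 6≤m) λ ())

  Index : Set
  Index = Fin (suc (m + m))

  Tuple : Set
  Tuple = Vec Bool (suc (m + m))

  pt : Point → Index
  pt (b , true)  = suc (b ↑ˡ m)
  pt (b , false) = suc (m ↑ʳ b)

  elim : {A : Set} → A → (Point → A) → Index → A
  elim x f zero    = x
  elim x f (suc i) = [ (λ b → f (b , true)) , (λ b → f (b , false)) ]′ (splitAt m i)

  elim-pt : {A : Set} (x : A) (f : Point → A) (q : Point) → elim x f (pt q) ≡ f q
  elim-pt x f (b , true)  rewrite splitAt-↑ˡ m b m = refl
  elim-pt x f (b , false) rewrite splitAt-↑ʳ m m b = refl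

  view : (i : Index) → i ≡ zero ⊎ ∃[ q ] (i ≡ pt q)
  view zero    = inj₁ refl
  view (suc i) = inj₂ (point (splitAt m i) (join-splitAt m m i))
    where
    point : ∀ x → joinFin m m x ≡ i → ∃[ q ] (suc i ≡ pt q)
    point (inj₁ b) eq = (b , true) , cong suc (sym eq)
    point (inj₂ b) eq = (b , false) , cong suc (sym eq)

  pt≢zero : ∀ q → pt q ≢ zero
  pt≢zero (b , true) ()
  pt≢zero (b , false) ()

  pt-injective : ∀ {q r} → pt q ≡ pt r → q ≡ r
  pt-injective {q} {r} eq = trans (sym (elim-pt q id q)) (trans (cong (elim q id) eq) (elim-pt q id r))

  config : Tuple → Config
  config v = lookup v ∘ pt

  tuple : Bool → Config → Tuple
  tuple x a = tabulate (elim x a)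

  config-tuple : ∀ x a → config (tuple x a) ≗ a
  config-tuple x a q = trans (lookup∘tabulate (elim x a) (pt q)) (elim-pt x a q)

  tuple-off : ∀ {x a a′ q} → (∀ r → r ≢ q → a r ≡ a′ r) → tuple x a agrees tuple x a′ off pt q
  tuple-off {x} {a} {a′} off k k≢ with view k
  ... | inj₁ refl = refl
  ... | inj₂ (r , refl) = trans (config-tuple x a r) (trans (off r (λ r≡q → k≢ (cong pt r≡q))) (sym (config-tuple x a′ r)))

  -- guardOp lies in the clone of x ∧ (y ∨ z), and choiceOp, which is
  -- selfdual, in that of majority.
  guardOp choiceOp : Bool → Op (suc (m + m))
  guardOp  β v = lookup v zero ∧ F β (config v)
  choiceOp β v = if lookup v zero then not (F β (complement (config v))) else F β (config v)

  complement-anti : ∀ {a a′} → a ≤ᶜ a′ → complement a′ ≤ᶜ complement a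
  complement-anti {a} a≤a′ q e with a q in eq
  ... | false = refl
  ... | true  = trans (sym (cong not (a≤a′ q eq))) e

  guardOp-monotone : ∀ β → Monotone (guardOp β)
  guardOp-monotone β v w v⊆w e with lookup v zero in eq
  ... | true rewrite v⊆w zero eq = F-mono (λ q → v⊆w (pt q)) e

  guardOp-𝟏 : ∀ β → guardOp β 𝟏 ≡ true
  guardOp-𝟏 β = on-F (inj₂ ((λ b → true , lookup-replicate (pt (b , true)) true)
                          , inj₁ (some-block , λ t → lookup-replicate (pt (some-block , t)) true)))

  guardOp-guarded : ∀ β v → guardOp β v ≡ true → lookup v zero ≡ true
  guardOp-guarded β v e with lookup v zero
  ... | true = refl

  choiceOp-monotone : ∀ β → Monotone (choiceOp β)
  choiceOp-monotone β v w v⊆w e with lookup v zero in eq | lookup w zero in eq′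
  ... | false | false = F-mono (λ q → v⊆w (pt q)) e
  ... | true  | false = contradiction (trans (sym eq′) (v⊆w zero eq)) λ ()
  -- Here the selector switches from `F β` to its dual, which lies above `F β` by `intersecting`.
  ... | false | true  = lemma (F β (complement (config w))) refl
    where
    lemma : ∀ x → F β (complement (config w)) ≡ x → not x ≡ true
    lemma false _  = refl
    lemma true  e′ = intersecting (F-mono {β} {config v} {config w} (λ q → v⊆w (pt q)) e) e′
  ... | true  | true  = lemma (F β (complement (config w))) refl
    where
    lemma : ∀ x → F β (complement (config w)) ≡ x → not x ≡ true
    lemma false _  = refl
    lemma true  e′ = contradiction (trans (sym (cong not (F-mono (complement-anti {config v} {config w} (λ q → v⊆w (pt q))) e′))) e) λ ()

  choiceOp-selfdual : ∀ β → dual (choiceOp β) ≗ choiceOp β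
  choiceOp-selfdual β v rewrite lookup-map zero not v with lookup v zero
  ... | true  = cong not (F-cong λ q → lookup-map (pt q) not v)
  ... | false = trans (not-involutive _) (F-cong λ q → trans (cong not (lookup-map (pt q) not v)) (not-involutive _))

  -- Strong hypomorphism

  flip : Fin m → Index → Index
  flip c = elim zero (pt ∘ τ c)

  flip-involutive : ∀ c i → flip c (flip c i) ≡ i
  flip-involutive c i with view i
  ... | inj₁ refl = refl
  ... | inj₂ (q , refl) = trans (cong (flip c) (elim-pt zero (pt ∘ τ c) q))
          (trans (elim-pt zero (pt ∘ τ c) (τ c q)) (cong pt (τ-involutive c q)))

  flip-fixes : ∀ {c b} → b ≢ c → ∀ t → flip c (pt (b , t)) ≡ pt (b , t)
  flip-fixes {c} {b} b≢c t = trans (elim-pt zero (pt ∘ τ c) (b , t)) (cong pt (τ-off c b≢c t))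

  config-flip : ∀ v c → config v ∘ τ c ≗ config (v [ flip c ])
  config-flip v c q = sym (trans (lookup-[] v (flip c) (pt q)) (cong (lookup v) (elim-pt zero (pt ∘ τ c) q)))

  F-flip-tuple : ∀ {β} v c → Mild c (config v) → F β (config v) ≡ F (not β) (config (v [ flip c ]))
  F-flip-tuple v c mild = trans (F-flip c mild) (F-cong (config-flip v c))

  guardOp-flip : ∀ {β} v c → (lookup v zero ≡ true → Mild c (config v)) → guardOp β v ≡ guardOp (not β) (v [ flip c ])
  guardOp-flip v c mild = under (lookup v zero) (F-flip-tuple v c ∘ mild)
    where
    under : ∀ x {y z} → (x ≡ true → y ≡ z) → x ∧ y ≡ x ∧ z
    under true  eq = eq refl
    under false eq = refl

  choiceOp-flip : ∀ {β} v c → (lookup v zero ≡ false → Mild c (config v)) → (lookup v zero ≡ true → Mild c (complement (config v))) →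
                  choiceOp β v ≡ choiceOp (not β) (v [ flip c ])
  choiceOp-flip v c mild mild′ = branch (lookup v zero)
    (λ e → cong not (trans (F-flip c (mild′ e)) (F-cong λ q → cong not (config-flip v c q))))
    (F-flip-tuple v c ∘ mild)
    where
    branch : ∀ x {y y′ z z′} → (x ≡ true → y ≡ y′) → (x ≡ false → z ≡ z′) →
             (if x then y else z) ≡ (if x then y′ else z′)
    branch true  eq eq′ = eq refl
    branch false eq eq′ = eq′ refl

  -- The block `c` precedes `p`, or precedes `q` if `q` itself precedes `p`. Then `s c` is one of
  -- the two blocks and the other is neither `c` nor `s c`. When the latter is full, the merged
  -- value occupies `s c`.
  mild-pair : ∀ {p q t u} → p ≢ q → ∃[ c ] (p ≢ c × q ≢ c × (∀ a → a (p , t) ≡ a (q , u) → Mild c a))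
  mild-pair {p} {q} {t} {u} p≢q with q ≟ s (s p)
  ... | no q≢c = s (s p) , ≢-sym (s²≢ p) , q≢c , λ a eq full →
    subst (Occupied a) (sym (s³ p)) (t , trans eq (full q q≢c (λ q≡ → p≢q (sym (trans q≡ (s³ p)))) u))
  ... | yes refl = s p , ≢-sym (s≢ p) , s≢ (s p) , λ a eq full →
    u , trans (sym eq) (full p (≢-sym (s≢ p)) (≢-sym (s²≢ p)) t)

  signs-merged : ∀ p t u → t ≢ u → (a : Config) → a (p , t) ≡ a (p , u) → a (p , true) ≡ a (p , false)
  signs-merged p true  true  t≢u a eq = contradiction refl t≢u
  signs-merged p true  false t≢u a eq = eq
  signs-merged p false true  t≢u a eq = sym eq
  signs-merged p false false t≢u a eq = contradiction refl t≢u

  -- For `c` = `s p`, the block `p` is neither `c` nor `s c`. Whichever value the selector has, the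
  -- configuration evaluated in its branch is false at (p , t), so `p` is not full and mildness
  -- holds vacuously.
  choiceOp-merged-zero : ∀ {β} p t v → lookup v zero ≡ config v (p , t) →
                         choiceOp β v ≡ choiceOp (not β) (v [ flip (s p) ])
  choiceOp-merged-zero p t v eq = choiceOp-flip v (s p)
    (λ e full → contradiction (trans (sym e) (trans eq (full p (≢-sym (s≢ p)) (≢-sym (s²≢ p)) t))) λ ())
    (λ e full → contradiction (trans (sym (cong not (trans (sym eq) e)))
                                     (full p (≢-sym (s≢ p)) (≢-sym (s²≢ p)) t)) λ ())

  guardOp-permuted : ∀ {β i j} → i ≢ j → Σ[ π ∈ (Index → Index) ] (π i ≡ i × π j ≡ j × (∀ k → π (π k) ≡ k) ×
     (∀ v → lookup v i ≡ lookup v j → guardOp β v ≡ guardOp (not β) (v [ π ])))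
  guardOp-permuted {β} {i} {j} i≢j with view i | view j
  ... | inj₁ refl | inj₁ refl = contradiction refl i≢j
  ... | inj₁ refl | inj₂ ((p , t) , refl) = flip (s (s p)) , refl , flip-fixes (≢-sym (s²≢ p)) t , flip-involutive _ ,
        λ v eq → guardOp-flip v _ λ e _ → subst (Occupied (config v)) (sym (s³ p)) (t , trans (sym eq) e)
  ... | inj₂ ((p , t) , refl) | inj₁ refl = flip (s (s p)) , flip-fixes (≢-sym (s²≢ p)) t , refl , flip-involutive _ ,
        λ v eq → guardOp-flip v _ λ e _ → subst (Occupied (config v)) (sym (s³ p)) (t , trans eq e)
  ... | inj₂ ((p , t) , refl) | inj₂ ((q , u) , refl) with p ≟ q
  ...   | no p≢q = let c , p≢c , q≢c , mild = mild-pair p≢q in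
          flip c , flip-fixes p≢c t , flip-fixes q≢c u , flip-involutive c ,
          λ v eq → guardOp-flip v c λ _ → mild (config v) eq
  ...   | yes refl = id , refl , refl , (λ _ → refl) , λ v eq →
          trans (cong (lookup v zero ∧_) (F-merged-block p (signs-merged p t u (λ t≡u → i≢j (cong (λ x → pt (p , x)) t≡u)) (config v) eq)))
                (cong (guardOp (not β)) (sym ([]-id v)))

  choiceOp-permuted : ∀ {β i j} → i ≢ j → Σ[ π ∈ (Index → Index) ] (π i ≡ i × π j ≡ j × (∀ k → π (π k) ≡ k) ×
     (∀ v → lookup v i ≡ lookup v j → choiceOp β v ≡ choiceOp (not β) (v [ π ])))
  choiceOp-permuted {β} {i} {j} i≢j with view i | view j
  ... | inj₁ refl | inj₁ refl = contradiction refl i≢j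
  ... | inj₁ refl | inj₂ ((p , t) , refl) = flip (s p) , refl , flip-fixes (≢-sym (s≢ p)) t , flip-involutive _ , choiceOp-merged-zero p t
  ... | inj₂ ((p , t) , refl) | inj₁ refl = flip (s p) , flip-fixes (≢-sym (s≢ p)) t , refl , flip-involutive _ , λ v → choiceOp-merged-zero p t v ∘ sym
  ... | inj₂ ((p , t) , refl) | inj₂ ((q , u) , refl) with p ≟ q
  ...   | no p≢q = let c , p≢c , q≢c , mild = mild-pair p≢q in
          flip c , flip-fixes p≢c t , flip-fixes q≢c u , flip-involutive c ,
          λ v eq → choiceOp-flip v c (λ _ → mild (config v) eq) (λ _ → mild (complement (config v)) (cong not eq))
  ...   | yes refl = id , refl , refl , (λ _ → refl) , λ v eq →
          trans (same v (signs-merged p t u (λ t≡u → i≢j (cong (λ x → pt (p , x)) t≡u)) (config v) eq)) (cong (choiceOp (not β)) (sym ([]-id v)))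
    where
    same : ∀ v → config v (p , true) ≡ config v (p , false) → choiceOp β v ≡ choiceOp (not β) v
    same v eq = cong₂ (λ x y → if lookup v zero then not x else y) (F-merged-block p (cong not eq)) (F-merged-block p eq)

  guardOp-stronglyHypomorphic : StronglyHypomorphic (guardOp true) (guardOp false)
  guardOp-stronglyHypomorphic = locally-permuted⇒stronglyHypomorphic {f = guardOp true} {guardOp false} guardOp-permuted

  choiceOp-stronglyHypomorphic : StronglyHypomorphic (choiceOp true) (choiceOp false)
  choiceOp-stronglyHypomorphic = locally-permuted⇒stronglyHypomorphic {f = choiceOp true} {choiceOp false} choiceOp-permuted

  -- Nonequivalence

  module _ {σ ρ : Index → Index} (σρ : ∀ i → σ (ρ i) ≡ i) (ρσ : ∀ i → ρ (σ i) ≡ i) where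

    private
      ρ-moves : ∀ {i j} → σ i ≡ j → i ≡ ρ j
      ρ-moves {i} eq = trans (sym (ρσ i)) (cong ρ eq)

    rigid-fixing-zero : σ zero ≡ zero → (x : Bool) →
      (∀ v → lookup v zero ≡ x → F true (config v) ≡ F false (config (v [ σ ]))) → ∀ {A : Set} → A
    rigid-fixing-zero fixed x transfer = rigid σ′ ρ′ σρ′ ρσ′ transfer′
      where
      ρ-fixed : ρ zero ≡ zero
      ρ-fixed = sym (ρ-moves fixed)
      σ′ ρ′ : Point → Point
      σ′ q = elim q id (σ (pt q))
      ρ′ q = elim q id (ρ (pt q))
      pt-σ′ : ∀ q → pt (σ′ q) ≡ σ (pt q)
      pt-σ′ q with σ (pt q) in eq
      ... | i with view i
      ...   | inj₁ refl = contradiction (trans (ρ-moves eq) ρ-fixed) (pt≢zero q)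
      ...   | inj₂ (r , refl) = cong pt (elim-pt q id r)
      pt-ρ′ : ∀ q → pt (ρ′ q) ≡ ρ (pt q)
      pt-ρ′ q with ρ (pt q) in eq
      ... | i with view i
      ...   | inj₁ refl = contradiction (trans (sym (σρ (pt q))) (trans (cong σ eq) fixed)) (pt≢zero q)
      ...   | inj₂ (r , refl) = cong pt (elim-pt q id r)
      σρ′ : ∀ q → σ′ (ρ′ q) ≡ q
      σρ′ q = pt-injective (trans (pt-σ′ (ρ′ q)) (trans (cong σ (pt-ρ′ q)) (σρ (pt q))))
      ρσ′ : ∀ q → ρ′ (σ′ q) ≡ q
      ρσ′ q = pt-injective (trans (pt-ρ′ (σ′ q)) (trans (cong ρ (pt-σ′ q)) (ρσ (pt q))))
      transfer′ : ∀ a → F true a ≡ F false (a ∘ σ′)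
      transfer′ a = trans (F-cong λ q → sym (config-tuple x a q)) (trans (transfer (tuple x a) refl) (F-cong λ q →
        trans (lookup-[] (tuple x a) σ (pt q)) (trans (cong (lookup (tuple x a)) (sym (pt-σ′ q))) (config-tuple x a (σ′ q)))))

    tuple-without : ∀ {x S i} → i ≢ zero → (∀ {q} → q ∈ᴸ S → i ≢ pt q) → lookup (tuple x (without S)) i ≡ true
    tuple-without {x} {S} {i} i≢zero i∉S with view i
    ... | inj₁ refl = contradiction refl i≢zero
    ... | inj₂ (q , refl) = trans (config-tuple x (without S) q) (without-∉ λ q∈S → i∉S q∈S refl)

    -- Argument `zero` is the only one that forces the value false when it alone is false.
    guardOp-fixes-zero : (∀ v → guardOp true v ≡ guardOp false (v [ σ ])) → σ zero ≡ zero
    guardOp-fixes-zero f≗ with view (ρ zero)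
    ... | inj₁ fixed = trans (cong σ (sym fixed)) (σρ zero)
    ... | inj₂ (y , ρ₀≡y) with view (σ zero)
    ...   | inj₁ fixed = fixed
    ...   | inj₂ (q , σ₀≡q) = contradiction (trans (f≗ v) (cong₂ _∧_ at-zero (F-mono below free))) λ ()
      where
      -- One point, repeated to fit the three places of `partner-free-on`.
      S = y ∷ y ∷ y ∷ []
      v = tuple false (λ _ → true)
      v-true : ∀ {i} → i ≢ zero → lookup v i ≡ true
      v-true {i} i≢zero with view i
      ... | inj₁ refl = contradiction refl i≢zero
      ... | inj₂ (r , refl) = config-tuple false (λ _ → true) r
      at-zero : lookup (v [ σ ]) zero ≡ true
      at-zero = trans (lookup-[] v σ zero) (v-true λ eq → pt≢zero q (trans (sym σ₀≡q) eq))
      below : without S ≤ᶜ config (v [ σ ])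
      below r e = trans (lookup-[] v σ (pt r)) (v-true λ eq →
        without-true {S} e (here (pt-injective (trans (ρ-moves eq) ρ₀≡y))))
      free : F false (without S) ≡ true
      free = partner-free-on λ { q q∈ q̄∈ → contradiction (trans (only q̄∈) (sym (only q∈))) partner≢ }
        where
        only : ∀ {q} → q ∈ᴸ S → q ≡ y
        only (here eq) = eq
        only (there (here eq)) = eq
        only (there (there (here eq))) = eq

    -- If `zero` went to a point of block `p`, take four zeros: `zero`, the block `s p` and a point
    -- of `s (s p)`. They make the value false. After the substitution the selector is true, and
    -- four zeros are too few for the dual to be false.
    choiceOp-fixes-zero : (∀ v → choiceOp true v ≡ choiceOp false (v [ σ ])) → σ zero ≡ zero
    choiceOp-fixes-zero f≗ with view (σ zero)
    ... | inj₁ fixed = fixed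
    ... | inj₂ ((p , t) , σ₀≡p) = contradiction (trans (sym v-off) (trans (f≗ v) w-on)) λ ()
      where
      e = s p
      z = s (s p)
      S = (e , true) ∷ (e , false) ∷ (z , true) ∷ []
      v = tuple false (without S)
      w = v [ σ ]
      v-off : choiceOp true v ≡ false
      v-off = trans (F-cong (config-tuple false (without S)))
        (empty-block-off {z = z} {t = true} (λ { true → without-∈ {S} (here refl) ; false → without-∈ {S} (there (here refl)) })
          (s≢ (s p)) (without-∈ {S} (there (there (here refl)))) (inj₂ refl))
      zeros : Fin 4 → Index
      zeros #0 = zero
      zeros #1 = pt (e , true)
      zeros #2 = pt (e , false)
      zeros #3 = pt (z , true)
      block : Index → Fin m
      -- The value `p` at `zero` is an arbitrary default.
      block = elim p proj₁
      outside : Fin 4 → Fin m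
      outside = block ∘ ρ ∘ zeros
      empty : ∀ {b} → (∀ i → outside i ≢ b) → ∀ u → complement (config w) (b , u) ≡ false
      empty {b} missed u = cong not (trans (lookup-[] v σ (pt (b , u))) (tuple-without {false} {S}
        (avoids #0) λ { (here refl) → avoids #1 ; (there (here refl)) → avoids #2 ; (there (there (here refl))) → avoids #3 }))
        where
        avoids : ∀ i → σ (pt (b , u)) ≢ zeros i
        avoids i eq = missed i (trans (cong block (sym (ρ-moves eq))) (elim-pt p proj₁ (b , u)))
      b₁ = missed-value (≤-trans (n≤1+n 5) 6≤m) outside
      outside′ : Fin 5 → Fin m
      outside′ zero    = proj₁ b₁
      outside′ (suc i) = outside i
      -- Two blocks free of zeros are needed: the second avoids the blocks of the four zeros and the
      -- first such block, which takes six blocks.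
      b₂ = missed-value 6≤m outside′
      w-on : choiceOp false w ≡ true
      w-on = trans (cong (λ x → if x then not (F false (complement (config w))) else F false (config w)) at-zero)
        (cong not (two-empty-blocks-off (proj₂ b₂ zero) (empty (proj₂ b₁)) (empty (proj₂ b₂ ∘ suc))))
        where
        at-zero : lookup w zero ≡ true
        at-zero = trans (cong (lookup v) σ₀≡p) (trans (config-tuple false (without S) (p , t)) (without-∉ {S} λ
          { (here eq) → s≢ p (sym (cong proj₁ eq)) ; (there (here eq)) → s≢ p (sym (cong proj₁ eq))
          ; (there (there (here eq))) → s²≢ p (sym (cong proj₁ eq)) }))

  -- With the partner of (p , t) already false, this point alone keeps the block `p` occupied. The
  -- zero at (s p , true) ensures that emptying `p` does not create an exceptional configuration.
  point-essential : ∀ {β} (h : Op (suc (m + m))) x → (∀ v → lookup v zero ≡ x → h v ≡ F β (config v)) →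
                    ∀ q → ¬ Inessential h (pt q)
  point-essential {β} h x h≗F (p , t) iness = contradiction
    (trans (sym on) (trans (sym (value S)) (trans (iness (tuple x (without S)) (tuple x (without S′)) (tuple-off off-p)) (trans (value S′) off)))) λ ()
    where
    S S′ : List Point
    S  = (p , not t) ∷ (s p , true) ∷ (s p , true) ∷ []
    S′ = (p , t) ∷ S
    value : ∀ S → h (tuple x (without S)) ≡ F β (without S)
    value S = trans (h≗F _ refl) (F-cong (config-tuple x (without S)))
    off-p : ∀ r → r ≢ (p , t) → without S r ≡ without S′ r
    off-p r r≢ with r ∈? S
    ... | yes r∈ = trans (without-∈ r∈) (sym (without-∈ (there r∈)))
    ... | no r∉  = trans (without-∉ r∉) (sym (without-∉ λ { (here eq) → r≢ eq ; (there r∈) → r∉ r∈ }))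
    on : F β (without S) ≡ true
    on = partner-free-on λ
      { q (here refl) (here eq) → partner≢ eq
      ; q (here refl) (there (here eq)) → s≢ p (sym (cong proj₁ eq))
      ; q (here refl) (there (there (here eq))) → s≢ p (sym (cong proj₁ eq))
      ; q (there (here refl)) (here eq) → s≢ p (cong proj₁ eq)
      ; q (there (here refl)) (there (here ()))
      ; q (there (here refl)) (there (there (here ())))
      ; q (there (there (here refl))) (here eq) → s≢ p (cong proj₁ eq)
      ; q (there (there (here refl))) (there (here ()))
      ; q (there (there (here refl))) (there (there (here ()))) }
    empty : ∀ u → without S′ (p , u) ≡ false
    empty u with u ≟ᵇ t
    ... | yes refl = without-∈ (here refl)
    ... | no u≢t   = without-∈ (there (here (cong (p ,_) (¬-not u≢t))))
    off : F β (without S′) ≡ false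
    off = empty-block-off {t = true} empty (s≢ p) (without-∈ {S′} (there (there (here refl)))) (inj₂ refl)

  guardOp-essential : ∀ {β} i → ¬ Inessential (guardOp β) i
  guardOp-essential {β} i iness with view i
  ... | inj₂ (q , refl) = point-essential (guardOp β) true (λ v e → cong (_∧ F β (config v)) e) q iness
  ... | inj₁ refl = contradiction (trans (sym on) (iness (tuple true (λ _ → true)) (tuple false (λ _ → true))
                      λ { zero 0≢0 → contradiction refl 0≢0 ; (suc k) _ → refl })) λ ()
    where
    on : F β (config (tuple true (λ _ → true))) ≡ true
    on = on-F (inj₂ ((λ b → true , config-tuple true (λ _ → true) (b , true))
                   , inj₁ (some-block , λ t → config-tuple true (λ _ → true) (some-block , t))))

  choiceOp-essential : ∀ {β} i → ¬ Inessential (choiceOp β) i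
  choiceOp-essential {β} i iness with view i
  ... | inj₂ (q , refl) = point-essential (choiceOp β) false
          (λ v e → cong (λ x → if x then not (F β (complement (config v))) else F β (config v)) e) q iness
  ... | inj₁ refl = contradiction (trans (sym on) (trans (iness (tuple true K) (tuple false K)
                      λ { zero 0≢0 → contradiction refl 0≢0 ; (suc k) _ → refl }) off)) λ ()
    where
    e = some-block
    S = (e , true) ∷ (e , false) ∷ (s e , true) ∷ []
    K = without S
    far = avoid₃ (≤-trans (m≤m+n 4 2) 6≤m) e (s e) (s (s e))
    empty : ∀ {b} → b ≢ e → b ≢ s e → ∀ t → complement K (b , t) ≡ false
    empty b≢e b≢se t = cong not (without-∉ {S} λ
      { (here eq) → b≢e (cong proj₁ eq) ; (there (here eq)) → b≢e (cong proj₁ eq) ; (there (there (here eq))) → b≢se (cong proj₁ eq) })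
    on : choiceOp β (tuple true K) ≡ true
    on = cong not (trans (F-cong λ q → cong not (config-tuple true K q))
      (two-empty-blocks-off (≢-sym (proj₂ (proj₂ (proj₂ far)))) (empty (s²≢ e) (s≢ (s e))) (empty (proj₁ (proj₂ far)) (proj₁ (proj₂ (proj₂ far))))))
    off : choiceOp β (tuple false K) ≡ false
    off = trans (F-cong (config-tuple false K)) (empty-block-off {t = true}
      (λ { true → without-∈ {S} (here refl) ; false → without-∈ {S} (there (here refl)) })
      (s≢ e) (without-∈ {S} (there (there (here refl)))) (inj₂ refl))

  guardOp-inequivalent : ¬ (guardOp true ≈ guardOp false)
  guardOp-inequivalent (minor@(σ , f≗) , _) =
    let ρ , σρ , ρσ = essential-minor-bijective {f = guardOp true} {guardOp false} guardOp-essential minor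
        fixed = guardOp-fixes-zero {σ} {ρ} σρ ρσ f≗
    in rigid-fixing-zero {σ} {ρ} σρ ρσ fixed true λ v e →
      trans (sym (cong (_∧ F true (config v)) e)) (trans (f≗ v)
        (cong (_∧ F false (config (v [ σ ]))) (trans (cong (lookup v) fixed) e)))

  choiceOp-inequivalent : ¬ (choiceOp true ≈ choiceOp false)
  choiceOp-inequivalent (minor@(σ , f≗) , _) =
    let ρ , σρ , ρσ = essential-minor-bijective {f = choiceOp true} {choiceOp false} choiceOp-essential minor
        fixed = choiceOp-fixes-zero {σ} {ρ} σρ ρσ f≗
        choose β v x = if x then not (F β (complement (config v))) else F β (config v)
    in rigid-fixing-zero {σ} {ρ} σρ ρσ fixed false λ v e →
      trans (sym (cong (choose true v) e)) (trans (f≗ v)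
        (cong (choose false (v [ σ ])) (trans (cong (lookup v) fixed) e)))

-- An odd number of three-cycles of blocks

orbits : ℕ → ℕ
-- Three is the least odd number of cycles that yields at least six blocks.
orbits zero    = 3
orbits (suc j) = 2 + orbits j

blocks-odd : ∀ j → odd (orbits j * 3) ≡ true
blocks-odd zero    = refl
blocks-odd (suc j) = trans (not-involutive _) (trans (not-involutive _) (trans (not-involutive _) (blocks-odd j)))

blocks-large : ∀ j → 6 + j ≤ orbits j * 3
blocks-large zero    = m≤m+n 6 3
blocks-large (suc j) = s≤s (≤-trans (blocks-large j) (m≤n+m _ 5))

rotate₃ : Fin 3 → Fin 3
rotate₃ #0 = #1
rotate₃ #1 = #2
rotate₃ #2 = #0

rotate₃³ : ∀ r → rotate₃ (rotate₃ (rotate₃ r)) ≡ r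
rotate₃³ #0 = refl
rotate₃³ #1 = refl
rotate₃³ #2 = refl

rotate₃≢ : ∀ r → rotate₃ r ≢ r
rotate₃≢ #0 ()
rotate₃≢ #1 ()
rotate₃≢ #2 ()

rotate : ∀ k → Fin (k * 3) → Fin (k * 3)
rotate k b = combine (proj₁ (remQuot {k} 3 b)) (rotate₃ (proj₂ (remQuot {k} 3 b)))

rotate-combine : ∀ {k} (q : Fin k) r → rotate k (combine q r) ≡ combine q (rotate₃ r)
rotate-combine q r = cong (λ x → combine (proj₁ x) (rotate₃ (proj₂ x))) (remQuot-combine q r)

rotate³ : ∀ k b → rotate k (rotate k (rotate k b)) ≡ b
rotate³ k b = trans (cong (rotate k) (rotate-combine q (rotate₃ r))) (trans (rotate-combine q (rotate₃ (rotate₃ r)))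
  (trans (cong (combine q) (rotate₃³ r)) (combine-remQuot {k} 3 b)))
  where
  q = proj₁ (remQuot {k} 3 b)
  r = proj₂ (remQuot {k} 3 b)

rotate≢ : ∀ k b → rotate k b ≢ b
rotate≢ k b eq = rotate₃≢ r (cong proj₂ (trans (sym (remQuot-combine q (rotate₃ r))) (cong (remQuot {k} 3) eq)))
  where
  q = proj₁ (remQuot {k} 3 b)
  r = proj₂ (remQuot {k} 3 b)

module Example (j : ℕ) where
  open Operations (rotate (orbits j)) (rotate³ (orbits j)) (rotate≢ (orbits j))
    (≤-trans (m≤m+n 6 j) (blocks-large j)) (blocks-odd j) public

  arity-large : j ≤ suc (orbits j * 3 + orbits j * 3)
  arity-large = ≤-trans (≤-trans (m≤n+m j 6) (blocks-large j)) (≤-trans (m≤m+n _ _) (n≤1+n _))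

-- Hypomorphic pairs inside a clone, and the dichotomy

StronglyHypomorphicPairs : ∀ {ℓ} → Class ℓ → Set ℓ
StronglyHypomorphicPairs C = ∀ N → ∃[ n ] ∃[ f ] ∃[ g ]
  (N ≤ suc n × f ∈ C {n} × g ∈ C {n} × StronglyHypomorphic f g × ¬ (f ≈ g))

majority-pairs : ∀ {ℓ} {C : Class ℓ} → IsClone C → ternary majority ∈ C → StronglyHypomorphicPairs C
majority-pairs {C = C} isClone majority∈C N =
  _ , choiceOp true , choiceOp false , arity-large , member true , member false ,
  choiceOp-stronglyHypomorphic , choiceOp-inequivalent
  where
  open Example N
  member : ∀ β → choiceOp β ∈ C
  member β = Interpolation.monotone-selfdual-∈ isClone majority∈C (choiceOp-monotone β) (choiceOp-selfdual β)

meetJoin-pairs : ∀ {ℓ} {C : Class ℓ} → IsClone C → ternary meetJoin ∈ C → StronglyHypomorphicPairs C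
meetJoin-pairs {C = C} isClone meetJoin∈C N =
  _ , guardOp true , guardOp false , arity-large , member true , member false ,
  guardOp-stronglyHypomorphic , guardOp-inequivalent
  where
  open Example N
  member : ∀ β → guardOp β ∈ C
  member β = Interpolation.monotone-guarded-∈ isClone meetJoin∈C (guardOp-monotone β) (guardOp-𝟏 β) (guardOp-guarded β)

dual-pairs : ∀ {ℓ} {C : Class ℓ} → StronglyHypomorphicPairs (Dual C) → StronglyHypomorphicPairs C
dual-pairs pairs N =
  let n , f , g , N≤n , f∈ , g∈ , strong , inequivalent = pairs N
  in n , dual f , dual g , N≤n , f∈ , g∈ , (λ I → dual-card {f = f} {g} I I (strong I)) ,
     λ eq → inequivalent (dual-≈⁻¹ {f = f} {g} eq)

pairs⇒¬weaklyReconstructible : ∀ {ℓ} {C : Class ℓ} → StronglyHypomorphicPairs C → ∀ n → ¬ WeaklyReconstructible (C ^≥ n)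
pairs⇒¬weaklyReconstructible pairs n weakly =
  let _ , f , g , n≤ , f∈ , g∈ , strong , inequivalent = pairs n
  in inequivalent (weakly f g (f∈ , n≤) (g∈ , n≤) (↔-id _ , strong))

theorem5p4 : ∀ {ℓ} → ExcludedMiddle ℓ → (C : Class ℓ) → IsClone C →
    ((C ⊑ Λ ⊎ C ⊑ V ⊎ C ⊑ L) → Reconstructible (C ^≥ 4))
    × (¬ (C ⊑ Λ ⊎ C ⊑ V ⊎ C ⊑ L) →
    (∀ n → 1 ≤ n → ¬ WeaklyReconstructible (C ^≥ n))
    × (∀ N → ∃[ n ] ∃[ f ] ∃[ g ] (N ≤ suc n × f ∈ C {n} × g ∈ C {n} × StronglyHypomorphic f g × ¬ (f ≈ g))))
theorem5p4 {ℓ} em C isClone = reconstructible , λ C⋢ →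
  let pairs = nonreconstructible (generators em isClone C⋢)
  in (λ n _ → pairs⇒¬weaklyReconstructible pairs n) , pairs
  where
  em₀ = lower-em em
  reconstructible : C ⊑ Λ ⊎ C ⊑ V ⊎ C ⊑ L → Reconstructible (C ^≥ 4)
  reconstructible (inj₁ C⊑Λ)        f (f∈C , 4≤n) = Λ-reconstructible em₀ f (C⊑Λ f f∈C , 4≤n)
  reconstructible (inj₂ (inj₁ C⊑V)) f (f∈C , 4≤n) = V-reconstructible em₀ f (C⊑V f f∈C , 4≤n)
  reconstructible (inj₂ (inj₂ C⊑L)) f (f∈C , 4≤n) = L-reconstructible em₀ f (C⊑L f f∈C , 4≤n)
  nonreconstructible : ternary majority ∈ C ⊎ ternary meetJoin ∈ C ⊎ ternary meetJoin ∈ Dual C → StronglyHypomorphicPairs C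
  nonreconstructible (inj₁ majority∈C)        = majority-pairs isClone majority∈C
  nonreconstructible (inj₂ (inj₁ meetJoin∈C)) = meetJoin-pairs isClone meetJoin∈C
  nonreconstructible (inj₂ (inj₂ meetJoin∈D)) = dual-pairs {C = C} (meetJoin-pairs (dual-isClone isClone) meetJoin∈D)
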